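{- Let $q$ be a prime power and $d$ a positive integer dividing $q-1$. Let $$\mathcal{E}=\{(2,1),(3,1),(3,2),(4,3),(5,2),(5,4),(7,2),(7,3),(7,6),(13,4)\}.$$ If $(q,d)\in\mathcal{E}$, then no orthomorphism in $\mathscr{D}_d(q)$ is orthogonal to a linear orthomorphism. If $(q,d)\notin\mathcal{E}$, and it is not the case that $d>50$ and ($q=2d+1\equiv3\pmod 4$ or $q=3d+1$), then there exists an orthomorphism $\theta\in\mathscr{D}_d(q)$ which is orthogonal to some linear orthomorphism over $\mathbb{F}_q$.
   Context: Let $\mathbb{F}_q$ be the finite field of order $q$. An orthomorphism is a permutation $\theta$ of $\mathbb{F}_q$ such that $x\mapsto\theta(x)-x$ is also a permutation. Two orthomorphisms $\theta,\theta'$ are orthogonal if $x\mapsto\theta(x)-\theta'(x)$ is a permutation. For $k\mid(q-1)$, fix a generator $g$ of $\mathbb{F}_q^*$ and let $C_{k,i}=\{g^j: j\equiv i\pmod k\}$, $0\le i<k$. A cyclotomic map of index $k$ with multipliers $[a_0,\dots,a_{k-1}]$ is $\theta(0)=0$, $\theta(x)=a_ix$ for $x\in C_{k,i}$. $\mathscr{C}_k(q)$ is the set of orthomorphisms that are cyclotomic maps of index $k$, and $\mathscr{D}_k(q)=\mathscr{C}_k(q)\setminus\bigcup_{\ell<k,\ \ell\mid(q-1)}\mathscr{C}_\ell(q)$. A linear orthomorphism is an element of $\mathscr{C}_1(q)$, i.e. a map $x\mapsto cx$ with $c\in\mathbb{F}_q\setminus\{0,1\}$. -}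

module Defs where

open import Level using (0ℓ)
open import Data.Nat using (ℕ; zero; suc; _∸_; _^_; _<_; _%_; NonZero)
import Data.Nat as ℕ
open import Data.Nat.Primality using (Prime)
open import Data.Nat.Divisibility using (_∣_)
open import Data.Fin using (Fin; toℕ)
open import Data.Product using (Σ; ∃; _×_; _,_)
open import Data.Sum using (_⊎_)
open import Data.List using (List; []; _∷_)
open import Relation.Binary.PropositionalEquality using (_≡_; _≢_)
open import Relation.Nullary using (¬_)
open import Function.Bundles using (_↔_)
open import Function.Definitions using (Bijective)
open import Algebra.Structures using (IsCommutativeRing)

IsPrimePower : ℕ → Set
IsPrimePower q = Σ ℕ λ p → Σ ℕ λ k → Prime p × 0 < k × q ≡ p ^ k

record FiniteField (q : ℕ) : Set₁ where
  infixl 7 _*_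
  infixl 6 _+_ _-_
  field
    Carrier : Set
    _+_ _*_ : Carrier → Carrier → Carrier
    -_ : Carrier → Carrier
    0# 1# : Carrier
    isCommutativeRing : IsCommutativeRing _≡_ _+_ _*_ -_ 0# 1#
    0≢1 : 0# ≢ 1#
    inverse : ∀ x → x ≢ 0# → Σ Carrier λ y → x * y ≡ 1#
    card : Carrier ↔ Fin q

  _-_ : Carrier → Carrier → Carrier
  x - y = x + (- y)

  pow : Carrier → ℕ → Carrier
  pow g zero = 1#
  pow g (suc j) = g * pow g j

  IsPermutation : (Carrier → Carrier) → Set
  IsPermutation f = Bijective _≡_ _≡_ f

  IsOrthomorphism : (Carrier → Carrier) → Set
  IsOrthomorphism θ = IsPermutation θ × IsPermutation (λ x → θ x - x)

  Orthogonal : (Carrier → Carrier) → (Carrier → Carrier) → Set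
  Orthogonal θ θ' = IsPermutation (λ x → θ x - θ' x)

  IsGenerator : Carrier → Set
  IsGenerator g = g ≢ 0# × (∀ x → x ≢ 0# → Σ ℕ λ j → x ≡ pow g j)

  -- linear orthomorphism x ↦ c x, c ∉ {0,1}
  IsLinearMultiplier : Carrier → Set
  IsLinearMultiplier c = c ≢ 0# × c ≢ 1#

  module _ (g : Carrier) where

    InCyclotomicClass : (k : ℕ) → .{{_ : NonZero k}} → ℕ → Carrier → Set
    InCyclotomicClass k i x = Σ ℕ λ j → j % k ≡ i × x ≡ pow g j

    IsCyclotomicMap : (k : ℕ) → .{{_ : NonZero k}} → (Carrier → Carrier) → Set
    IsCyclotomicMap k θ =
      θ 0# ≡ 0# ×
      Σ (Fin k → Carrier) λ a →
        ∀ (i : Fin k) (x : Carrier) → InCyclotomicClass k (toℕ i) x → θ x ≡ a i * x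

    InC : (k : ℕ) → .{{_ : NonZero k}} → (Carrier → Carrier) → Set
    InC k θ = IsCyclotomicMap k θ × IsOrthomorphism θ

    InD : (k : ℕ) → .{{_ : NonZero k}} → (Carrier → Carrier) → Set
    InD k θ = InC k θ ×
      (∀ (ℓ : ℕ) → .{{_ : NonZero ℓ}} → ℓ < k → ℓ ∣ q ∸ 1 → ¬ InC ℓ θ)

ℰ : List (ℕ × ℕ)
ℰ = (2 , 1) ∷ (3 , 1) ∷ (3 , 2) ∷ (4 , 3) ∷ (5 , 2) ∷ (5 , 4) ∷ (7 , 2) ∷ (7 , 3) ∷ (7 , 6) ∷ (13 , 4) ∷ []

LargeExcluded : ℕ → ℕ → Set
LargeExcluded q d = 50 < d × ((q ≡ 2 ℕ.* d ℕ.+ 1 × q % 4 ≡ 3) ⊎ q ≡ 3 ℕ.* d ℕ.+ 1)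

-- Let q − 1 = f d, and let H be the group of f-th roots of unity.  A map θ with θ(0) = 0 is
-- cyclotomic of index d exactly if it commutes with multiplication by H, and the index is minimal
-- if no multiplication outside H commutes with θ.  We look for θ = a x + e η(x) with η commuting
-- exactly with H.  For distinct nonzero μ₁, μ₂, μ₃ one can choose a, c, e such that θ, θ − x and
-- θ − c x are nonzero multiples of x + μᵢ η(x), so all that matters is that these three maps are
-- injective.  That follows if η(x + μ η(x)) = u η(x) for some u ≠ 0.
--
-- If f ≥ 4, let η(x) = x on H and 0 elsewhere, with μ = u − 1 for u ∈ H ∖ {1}.  If f ≤ 3, take a
-- group K of n ≥ 4 roots of unity and let η be k y at k (t + y), k ∈ H, y ∈ K, and 0 elsewhere;
-- for f = 2, 3 the sets k (t + K) are disjoint for a suitable t as soon as n² + 1 < q.  Additive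
-- analogues (an additive group of order 4 in place of K for f = 1, η(x) = x^(f+1) if q is 9, 27 or
-- 16) serve in small characteristic, and for the few remaining primes η is given by a table.
--
-- For the pairs of ℰ with q ≤ 4 there is no room for enough distinct values of θ; for q = 5, 7, 13
-- a backtracking search over ℤ/q shows that θ commutes with too many multiplications.
module Submission where

open import Defs
open import Level using (0ℓ)
open import Algebra.Bundles using (CommutativeRing)
import Algebra.Solver.Ring as RingSolver
open import Algebra.Solver.Ring.AlmostCommutativeRing using (fromCommutativeRing; _-Raw-AlmostCommutative⟶_)
open import Data.Fin using (Fin; zero; suc; toℕ; fromℕ<; combine; remQuot; punchOut)
open import Data.Fin.Patterns using (0F; 1F; 2F; 3F)
import Data.Fin.Properties as Fin
open import Data.Integer using (ℤ; -[1+_]; _⊖_; _◃_)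
import Data.Integer as ℤ
import Data.Integer.Properties as ℤₚ
open import Data.List using (List; []; _∷_; _++_; map; length; lookup)
import Data.List.Membership.DecPropositional as Membership
open import Data.List.Membership.Propositional using (_∈_; _∉_)
open import Data.List.Membership.Propositional.Properties using (∈-lookup)
open import Data.List.Relation.Unary.All using (All; []; _∷_)
import Data.List.Relation.Unary.All as All
import Data.List.Relation.Unary.All.Properties as All
open import Data.List.Relation.Unary.AllPairs using ([]; _∷_)
open import Data.List.Relation.Unary.Any using (Any)
import Data.List.Relation.Unary.Any as Any
open import Data.List.Relation.Unary.Unique.Propositional using (Unique)
import Data.Maybe as Maybe
open import Data.Nat using (ℕ; zero; suc; _∸_; _≤_; _<_; NonZero; z≤n; s≤s; z<s; s<s)
import Data.Nat as ℕ
open import Data.Nat.Coprimality using (prime⇒coprime; coprime-Bézout)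
open import Data.Nat.Divisibility using
  (_∣_; _∣?_; divides; ∣⇒≤; >⇒∤; *-cancelʳ-∣; ∣m+n∣m⇒∣n; ∣1⇒≡1; n∣m*n; m%n≡0⇒n∣m)
import Data.Nat.DivMod as ℕ
open import Data.Nat.GCD using (module Bézout)
open import Data.Nat.Induction using (<-rec)
open import Data.Nat.Primality using
  (Prime; prime?; prime⇒nonZero; prime⇒nonTrivial; prime⇒irreducible; euclidsLemma; ¬prime[1])
import Data.Nat.Properties as ℕₚ
open import Data.Product using (Σ; ∃; _×_; _,_; proj₁; proj₂)
import Data.Product.Properties as Product
import Data.Sign as Sign
open import Data.Sum using (_⊎_; inj₁; inj₂)
open import Data.Vec.Functional using (replicate)
open import Function using (_∘_; id; case_of_)
open import Function.Bundles using (Inverse; _↔_; mk↔ₛ′)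
open import Function.Construct.Composition using (_↔-∘_)
open import Function.Construct.Symmetry using (↔-sym)
open import Function.Definitions using (Injective)
open import Relation.Binary.PropositionalEquality
open import Relation.Nullary using (¬_; Dec; yes; no; contradiction)
import Relation.Nullary.Decidable as Dec
open import Relation.Nullary.Decidable using
  (True; from-yes; toWitness; decidable-stable; ¬?; _×-dec_; _⊎-dec_; _→-dec_)
open import Relation.Unary using (Decidable)

open Membership (Product.≡-dec ℕ._≟_ ℕ._≟_) using () renaming (_∈?_ to _∈ᵖ?_)
open Membership ℕ._≟_ using (_∈?_)

-- Finite fields: counting, characteristic and cancellation.

injective⇒surjective : ∀ {n} (f : Fin n → Fin n) → Injective _≡_ _≡_ f → ∀ y → ∃ λ x → f x ≡ y
injective⇒surjective {suc n} f inj y with Fin.any? (λ x → f x Fin.≟ y)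
... | yes hit = hit
-- Deleting the missed value `y` from the codomain would inject `Fin (suc n)` into `Fin n`.
... | no miss = contradiction (Fin.injective⇒≤ squeeze-injective) ℕₚ.1+n≰n
  where
  squeeze : Fin (suc n) → Fin n
  squeeze x = punchOut {i = y} {j = f x} (λ y≡fx → miss (x , sym y≡fx))
  squeeze-injective : Injective _≡_ _≡_ squeeze
  squeeze-injective eq = inj (Fin.punchOut-injective {i = y} _ _ eq)

module Arithmetic {q : ℕ} (F : FiniteField q) where
  open FiniteField F public

  commutativeRing : CommutativeRing 0ℓ 0ℓ
  commutativeRing = record { isCommutativeRing = isCommutativeRing }

  open CommutativeRing commutativeRing public using
    ( +-assoc; +-comm; +-identityˡ; +-identityʳ; -‿inverseʳ
    ; *-assoc; *-comm; *-identityˡ; *-identityʳ; zeroˡ; zeroʳ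
    ; ring; semiring; +-commutativeMonoid )
  open import Algebra.Properties.Ring ring public using (-‿distribˡ-*; -‿distribʳ-*)
  open import Algebra.Properties.Group (CommutativeRing.+-group commutativeRing) public using ()
    renaming (x∙y⁻¹≈ε⇒x≈y to x-y≡0⇒x≡y; ⁻¹-involutive to -‿involutive)
  open import Algebra.Properties.AbelianGroup (CommutativeRing.+-abelianGroup commutativeRing) using ()
    renaming (⁻¹-∙-comm to -‿+-comm; ε⁻¹≈ε to -0≡0)
  open import Algebra.Properties.Semiring.Mult.TCOptimised semiring using (×1-homo-*)
  open import Algebra.Properties.Monoid.Mult.TCOptimised (CommutativeRing.+-monoid commutativeRing)
    using (×-homo-+; ×ᵤ≈×) renaming (_×_ to _·_)
  open import Algebra.Properties.CommutativeMonoid.Sum +-commutativeMonoid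
    using (sum; sum-permute; sum-cong-≗; ∑-distrib-+; sum-replicate)

  -- With this form of multiples `ι 1` is `1#` by computation, so the solver's constant 1 matches
  -- `1#` and `ι` can serve as its coefficient map.
  ι : ℕ → Carrier
  ι n = n · 1#

  ι-+ : ∀ m n → ι (m ℕ.+ n) ≡ ι m + ι n
  ι-+ = ×-homo-+ 1#

  ι-* : ∀ m n → ι (m ℕ.* n) ≡ ι m * ι n
  ι-* = ×1-homo-*

  ι-suc : ∀ n → ι (suc n) ≡ 1# + ι n
  ι-suc = ι-+ 1

  ιℤ : ℤ → Carrier
  ιℤ (ℤ.+ n) = ι n
  ιℤ -[1+ n ] = - ι (suc n)

  private
    ιℤ-⊖ : ∀ m n → ιℤ (m ⊖ n) ≡ ι m - ι n
    ιℤ-⊖ m zero = sym (trans (cong (ι m +_) -0≡0) (+-identityʳ _))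
    ιℤ-⊖ zero (suc n) = sym (+-identityˡ _)
    ιℤ-⊖ (suc m) (suc n) rewrite ℤₚ.[1+m]⊖[1+n]≡m⊖n m n = begin
      ιℤ (m ⊖ n)                         ≡⟨ ιℤ-⊖ m n ⟩
      ι m - ι n                          ≡⟨ cong (_- ι n) (+-identityʳ (ι m)) ⟨
      ι m + 0# - ι n                     ≡⟨ cong (λ z → ι m + z - ι n) (-‿inverseʳ 1#) ⟨
      ι m + (1# - 1#) - ι n              ≡⟨ cong (_- ι n) (+-assoc _ _ _) ⟨
      ι m + 1# - 1# - ι n                ≡⟨ +-assoc _ _ _ ⟩
      ι m + 1# + (- 1# + - ι n)          ≡⟨ cong₂ _+_ (+-comm _ _) (-‿+-comm 1# (ι n)) ⟩
      1# + ι m - (1# + ι n)              ≡⟨ cong₂ _-_ (ι-suc m) (ι-suc n) ⟨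
      ι (suc m) - ι (suc n)              ∎
      where open ≡-Reasoning

    ιℤ-+ : ∀ i j → ιℤ (i ℤ.+ j) ≡ ιℤ i + ιℤ j
    ιℤ-+ (ℤ.+ m) (ℤ.+ n) = ι-+ m n
    ιℤ-+ (ℤ.+ m) -[1+ n ] = ιℤ-⊖ m (suc n)
    ιℤ-+ -[1+ m ] (ℤ.+ n) = trans (ιℤ-⊖ n (suc m)) (+-comm _ _)
    ιℤ-+ -[1+ m ] -[1+ n ] = trans
      (cong -_ (trans (cong ι (cong suc (sym (ℕₚ.+-suc m n)))) (ι-+ (suc m) (suc n))))
      (sym (-‿+-comm _ _))

    ιℤ--◃ : ∀ n → ιℤ (Sign.- ◃ n) ≡ - ι n
    ιℤ--◃ zero = sym -0≡0
    ιℤ--◃ (suc n) = refl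

    ιℤ-+◃ : ∀ n → ιℤ (Sign.+ ◃ n) ≡ ι n
    ιℤ-+◃ zero = refl
    ιℤ-+◃ (suc n) = refl

    ιℤ-* : ∀ i j → ιℤ (i ℤ.* j) ≡ ιℤ i * ιℤ j
    ιℤ-* (ℤ.+ m) (ℤ.+ n) = trans (ιℤ-+◃ (m ℕ.* n)) (ι-* m n)
    ιℤ-* (ℤ.+ m) -[1+ n ] = trans (ιℤ--◃ (m ℕ.* suc n))
      (trans (cong -_ (ι-* m (suc n))) (-‿distribʳ-* _ _))
    ιℤ-* -[1+ m ] (ℤ.+ n) = trans (ιℤ--◃ (suc m ℕ.* n))
      (trans (cong -_ (ι-* (suc m) n)) (-‿distribˡ-* _ _))
    ιℤ-* -[1+ m ] -[1+ n ] = trans (ι-* (suc m) (suc n))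
      (trans (sym (-‿involutive _))
        (trans (cong -_ (-‿distribˡ-* _ _)) (-‿distribʳ-* _ _)))

    ιℤ-- : ∀ i → ιℤ (ℤ.- i) ≡ - ιℤ i
    ιℤ-- (ℤ.+ zero) = sym -0≡0
    ιℤ-- (ℤ.+ suc n) = refl
    ιℤ-- -[1+ n ] = sym (-‿involutive _)

    ιℤ-morphism : CommutativeRing.rawRing ℤₚ.+-*-commutativeRing
                  -Raw-AlmostCommutative⟶ fromCommutativeRing commutativeRing
    ιℤ-morphism = record
      { ⟦_⟧ = ιℤ ; +-homo = ιℤ-+ ; *-homo = ιℤ-* ; -‿homo = ιℤ-- ; 0-homo = refl ; 1-homo = refl }

  -- With integer coefficients the solver also cancels terms such as x − x.
  open RingSolver (CommutativeRing.rawRing ℤₚ.+-*-commutativeRing) (fromCommutativeRing commutativeRing)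
    ιℤ-morphism (λ i j → Maybe.map (cong ιℤ) (Dec.dec⇒maybe (i ℤ.≟ j)))
    public using (solve; _:=_; _:+_; _:*_; _:-_; :-_; con)

  module card = Inverse card

  card-injective : ∀ {x y} → card.to x ≡ card.to y → x ≡ y
  card-injective {x} {y} eq = trans (sym (card.strictlyInverseʳ x)) (trans (cong card.from eq) (card.strictlyInverseʳ y))

  infix 4 _≟_
  _≟_ : (x y : Carrier) → Dec (x ≡ y)
  x ≟ y = Dec.map′ card-injective (cong card.to) (card.to x Fin.≟ card.to y)

  ∃? : {P : Carrier → Set} → Decidable P → Dec (∃ P)
  ∃? {P} P? = Dec.map′ (λ (i , p) → card.from i , p)
    (λ (x , p) → card.to x , subst P (sym (card.strictlyInverseʳ x)) p) (Fin.any? (P? ∘ card.from))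

  -- Reduces every permutation claim of the construction to injectivity, by transport to `Fin q`.
  injective⇒permutation : ∀ {f} → (∀ {x y} → f x ≡ f y → x ≡ y) → IsPermutation f
  injective⇒permutation {f} inj = inj , λ y →
    let i , eq = injective⇒surjective (card.to ∘ f ∘ card.from)
                   (λ {i} {j} eq → trans (sym (card.strictlyInverseˡ i))
                     (trans (cong card.to (inj (card-injective eq))) (card.strictlyInverseˡ j)))
                   (card.to y)
    in card.from i , λ { refl → card-injective eq }

  -- The translation by 1 permutes the field, so it preserves the sum of all elements; but adding 1
  -- to each of the q summands adds `ι q`.
  ι-char : ι q ≡ 0#
  ι-char = begin
    ι q                    ≡⟨ solve 2 (λ s n → n := s :+ n :- s) refl (sum card.from) (ι q) ⟩
    sum card.from + ι q - sum card.from ≡⟨ cong (_- sum card.from) shift ⟨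
    sum card.from - sum card.from       ≡⟨ -‿inverseʳ _ ⟩
    0#                     ∎
    where
    open ≡-Reasoning
    translation : Carrier ↔ Carrier
    translation = mk↔ₛ′ (_+ 1#) (_- 1#)
      (solve 1 (λ x → x :- con (ℤ.+ 1) :+ con (ℤ.+ 1) := x) refl)
      (solve 1 (λ x → x :+ con (ℤ.+ 1) :- con (ℤ.+ 1) := x) refl)
    shift : sum card.from ≡ sum card.from + ι q
    shift = begin
      sum card.from                            ≡⟨ sum-permute card.from ((card ↔-∘ translation) ↔-∘ ↔-sym card) ⟩
      sum (λ i → card.from (card.to (card.from i + 1#)))  ≡⟨ sum-cong-≗ {q} (λ i → card.strictlyInverseʳ (card.from i + 1#)) ⟩
      sum (λ i → card.from i + 1#)             ≡⟨ ∑-distrib-+ card.from (replicate q 1#) ⟩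
      sum card.from + sum (replicate q 1#)     ≡⟨ cong (sum card.from +_) (trans (sum-replicate q) (×ᵤ≈× q 1#)) ⟩
      sum card.from + ι q                      ∎

  1≢0 : 1# ≢ 0#
  1≢0 = 0≢1 ∘ sym

  _⁻¹ : ∀ {x} → x ≢ 0# → Carrier
  x≢0 ⁻¹ = proj₁ (inverse _ x≢0)

  *-inverseʳ : ∀ {x} (x≢0 : x ≢ 0#) → x * x≢0 ⁻¹ ≡ 1#
  *-inverseʳ x≢0 = proj₂ (inverse _ x≢0)

  *-cancelˡ : ∀ {x y z} → x ≢ 0# → x * y ≡ x * z → y ≡ z
  *-cancelˡ {x} {y} {z} x≢0 eq = begin
    y                    ≡⟨ undo y ⟩
    x≢0 ⁻¹ * (x * y)     ≡⟨ cong (x≢0 ⁻¹ *_) eq ⟩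
    x≢0 ⁻¹ * (x * z)     ≡⟨ undo z ⟨
    z                    ∎
    where
    open ≡-Reasoning
    undo : ∀ y → y ≡ x≢0 ⁻¹ * (x * y)
    undo y = sym (trans (sym (*-assoc _ _ _))
      (trans (cong (_* y) (trans (*-comm _ _) (*-inverseʳ x≢0))) (*-identityˡ y)))

  *-cancelʳ : ∀ {x y z} → x ≢ 0# → y * x ≡ z * x → y ≡ z
  *-cancelʳ x≢0 eq = *-cancelˡ x≢0 (trans (*-comm _ _) (trans eq (*-comm _ _)))

  *-≢0 : ∀ {x y} → x ≢ 0# → y ≢ 0# → x * y ≢ 0#
  *-≢0 {x} x≢0 y≢0 eq = y≢0 (*-cancelˡ x≢0 (trans eq (sym (zeroʳ x))))

  *≡1⇒≢0 : ∀ {x y} → x * y ≡ 1# → x ≢ 0#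
  *≡1⇒≢0 {y = y} eq refl = 0≢1 (trans (sym (zeroˡ y)) eq)

  -‿≢0 : ∀ {x} → x ≢ 0# → - x ≢ 0#
  -‿≢0 x≢0 eq = x≢0 (trans (sym (-‿involutive _)) (trans (cong -_ eq) -0≡0))

  x≢y⇒x-y≢0 : ∀ {x y} → x ≢ y → x - y ≢ 0#
  x≢y⇒x-y≢0 x≢y eq = x≢y (x-y≡0⇒x≡y _ _ eq)

  pow-+ : ∀ x m n → pow x (m ℕ.+ n) ≡ pow x m * pow x n
  pow-+ x zero n = sym (*-identityˡ _)
  pow-+ x (suc m) n = trans (cong (x *_) (pow-+ x m n)) (sym (*-assoc _ _ _))

  pow-1 : ∀ n → pow 1# n ≡ 1#
  pow-1 zero = refl
  pow-1 (suc n) = trans (*-identityˡ _) (pow-1 n)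

  pow-distrib-* : ∀ x y n → pow (x * y) n ≡ pow x n * pow y n
  pow-distrib-* x y zero = sym (*-identityˡ _)
  pow-distrib-* x y (suc n) = trans (cong (x * y *_) (pow-distrib-* x y n))
    (solve 4 (λ x y u v → x :* y :* (u :* v) := x :* u :* (y :* v)) refl x y _ _)

  pow-* : ∀ x m n → pow x (m ℕ.* n) ≡ pow (pow x m) n
  pow-* x zero n = sym (pow-1 n)
  pow-* x (suc m) n = trans (pow-+ x n (m ℕ.* n))
    (trans (cong (pow x n *_) (pow-* x m n)) (sym (pow-distrib-* x (pow x m) n)))

  pow-≢0 : ∀ {x} n → x ≢ 0# → pow x n ≢ 0#
  pow-≢0 zero x≢0 = 1≢0
  pow-≢0 (suc n) x≢0 = *-≢0 x≢0 (pow-≢0 n x≢0)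

  ι-pow : ∀ m n → ι (m ℕ.^ n) ≡ pow (ι m) n
  ι-pow m zero = refl
  ι-pow m (suc n) = trans (ι-* m (m ℕ.^ n)) (cong (ι m *_) (ι-pow m n))

  pow≡1⇒≢0 : ∀ {x} n → n ≢ 0 → pow x n ≡ 1# → x ≢ 0#
  pow≡1⇒≢0 zero n≢0 _ = contradiction refl n≢0
  pow≡1⇒≢0 (suc n) _ eq = *≡1⇒≢0 eq

-- The cyclic group of units, and cyclotomic maps as equivariant maps.

least : {P : ℕ → Set} → Decidable P → ∀ n → P n → ∃ λ m → P m × (∀ k → k < m → ¬ P k)
least {P} P? = <-rec _ λ n rec pn → case ℕₚ.anyUpTo? P? n of λ where
  (yes (m , m<n , pm)) → rec m<n pm
  (no none) → n , pn , λ k k<n pk → none (k , k<n , pk)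

module Cyclic {q : ℕ} (F : FiniteField q) (g : FiniteField.Carrier F) (gen : FiniteField.IsGenerator F g) where
  open Arithmetic F public

  g≢0 : g ≢ 0#
  g≢0 = proj₁ gen

  pow-∸ : ∀ {x} → x ≢ 0# → ∀ {m n} → m ≤ n → pow x m ≡ pow x n → pow x (n ∸ m) ≡ 1#
  pow-∸ {x} x≢0 {m} {n} m≤n eq = *-cancelˡ (pow-≢0 m x≢0) (begin
    pow x m * pow x (n ∸ m)   ≡⟨ pow-+ x m (n ∸ m) ⟨
    pow x (m ℕ.+ (n ∸ m))     ≡⟨ cong (pow x) (ℕₚ.m+[n∸m]≡n m≤n) ⟩
    pow x n                   ≡⟨ eq ⟨
    pow x m                   ≡⟨ *-identityʳ _ ⟨
    pow x m * 1#              ∎)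
    where open ≡-Reasoning

  pow-*-1 : ∀ {x} m n → pow x m ≡ 1# → pow x (m ℕ.* n) ≡ 1#
  pow-*-1 {x} m n eq = trans (pow-* x m n) (trans (cong (λ z → pow z n) eq) (pow-1 n))

  private
    -- By the pigeonhole principle two of the q + 1 powers of `g` with exponents 0 to q coincide;
    -- their quotient is a trivial positive power.
    cycle : ∃ λ n → pow g (suc n) ≡ 1#
    cycle with Fin.pigeonhole (ℕₚ.n<1+n q) (λ i → card.to (pow g (toℕ i)))
    ... | i , j , i<j , eq = toℕ j ∸ suc (toℕ i) ,
      subst (λ k → pow g k ≡ 1#) (ℕₚ.+-∸-assoc 1 i<j) (pow-∸ g≢0 (ℕₚ.<⇒≤ i<j) (card-injective eq))

    abstract
      least-cycle : ∃ λ n → pow g (suc n) ≡ 1# × (∀ k → k < n → pow g (suc k) ≢ 1#)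
      least-cycle = least (λ n → pow g (suc n) ≟ 1#) (proj₁ cycle) (proj₂ cycle)

    -- The order of `g`, found below to be q - 1.
    N : ℕ
    N = suc (proj₁ least-cycle)

    pow-N : pow g N ≡ 1#
    pow-N = proj₁ (proj₂ least-cycle)

    <N⇒≡0 : ∀ n → n < N → pow g n ≡ 1# → n ≡ 0
    <N⇒≡0 zero _ _ = refl
    <N⇒≡0 (suc n) n<N eq = contradiction eq (proj₂ (proj₂ least-cycle) n (ℕ.s<s⁻¹ n<N))

    pow-% : ∀ n → pow g (n ℕ.% N) ≡ pow g n
    pow-% n = begin
      pow g (n ℕ.% N)                                 ≡⟨ *-identityʳ _ ⟨
      pow g (n ℕ.% N) * 1#                            ≡⟨ cong (pow g (n ℕ.% N) *_) (pow-*-1 N (n ℕ./ N) pow-N) ⟨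
      pow g (n ℕ.% N) * pow g (N ℕ.* (n ℕ./ N))       ≡⟨ pow-+ g (n ℕ.% N) _ ⟨
      pow g (n ℕ.% N ℕ.+ N ℕ.* (n ℕ./ N))             ≡⟨ cong (λ k → pow g (n ℕ.% N ℕ.+ k)) (ℕₚ.*-comm N (n ℕ./ N)) ⟩
      pow g (n ℕ.% N ℕ.+ n ℕ./ N ℕ.* N)               ≡⟨ cong (pow g) (ℕ.m≡m%n+[m/n]*n n N) ⟨
      pow g n                                         ∎
      where open ≡-Reasoning

    ≤N⇒≡ : ∀ {m n} → m ≤ n → n < N → pow g m ≡ pow g n → m ≡ n
    ≤N⇒≡ {m} {n} m≤n n<N eq = ℕₚ.≤-antisym m≤n (ℕₚ.m∸n≡0⇒m≤n
      (<N⇒≡0 (n ∸ m) (ℕₚ.≤-<-trans (ℕₚ.m∸n≤m n m) n<N) (pow-∸ g≢0 m≤n eq)))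

    element : Fin (suc N) → Carrier
    element zero = 0#
    element (suc i) = pow g (toℕ i)

    element-injective : ∀ i j → element i ≡ element j → i ≡ j
    element-injective zero zero eq = refl
    element-injective zero (suc j) eq = contradiction (sym eq) (pow-≢0 (toℕ j) g≢0)
    element-injective (suc i) zero eq = contradiction eq (pow-≢0 (toℕ i) g≢0)
    element-injective (suc i) (suc j) eq = cong suc (Fin.toℕ-injective
      (case ℕₚ.≤-total (toℕ i) (toℕ j) of λ where
        (inj₁ i≤j) → ≤N⇒≡ i≤j (Fin.toℕ<n j) eq
        (inj₂ j≤i) → sym (≤N⇒≡ j≤i (Fin.toℕ<n i) (sym eq))))

    element-surjective : ∀ x → ∃ λ i → element i ≡ x
    element-surjective x with x ≟ 0#
    ... | yes x≡0 = zero , sym x≡0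
    ... | no x≢0 with proj₂ gen x x≢0
    ...   | n , eq = suc (fromℕ< (ℕ.m%n<n n N)) ,
      trans (cong (pow g) (Fin.toℕ-fromℕ< (ℕ.m%n<n n N))) (trans (pow-% n) (sym eq))

    -- `element` runs through 0 and the `N` powers of `g` without omission and without repetition;
    -- each of the two properties gives one inequality.
    q≡1+N : q ≡ suc N
    q≡1+N = ℕₚ.≤-antisym
      (Fin.injective⇒≤ {f = λ i → proj₁ (element-surjective (card.from i))} (λ {i} {j} eq →
        trans (sym (card.strictlyInverseˡ i)) (trans (cong card.to (begin
          card.from i                                        ≡⟨ proj₂ (element-surjective (card.from i)) ⟨
          element (proj₁ (element-surjective (card.from i))) ≡⟨ cong element eq ⟩
          element (proj₁ (element-surjective (card.from j))) ≡⟨ proj₂ (element-surjective (card.from j)) ⟩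
          card.from j                                        ∎)) (card.strictlyInverseˡ j))))
      (Fin.injective⇒≤ {f = card.to ∘ element} (λ eq → element-injective _ _ (card-injective eq)))
      where open ≡-Reasoning

    q∸1≡N : q ∸ 1 ≡ N
    q∸1≡N = cong (_∸ 1) q≡1+N

  q≡1+[q∸1] : q ≡ suc (q ∸ 1)
  q≡1+[q∸1] = trans q≡1+N (cong suc (sym q∸1≡N))

  0<q∸1 : 0 < q ∸ 1
  0<q∸1 = subst (0 <_) (sym q∸1≡N) z<s

  pow-g-[q∸1] : pow g (q ∸ 1) ≡ 1#
  pow-g-[q∸1] = trans (cong (pow g) q∸1≡N) pow-N

  pow-g≡1⇒∣ : ∀ n → pow g n ≡ 1# → q ∸ 1 ∣ n
  pow-g≡1⇒∣ n eq = subst (_∣ n) (sym q∸1≡N) (m%n≡0⇒n∣m n N (<N⇒≡0 _ (ℕ.m%n<n n N) (trans (pow-% n) eq)))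

  pow-g-injective : ∀ {m n} → m < q ∸ 1 → n < q ∸ 1 → pow g m ≡ pow g n → m ≡ n
  pow-g-injective {m} {n} m< n< eq = case ℕₚ.≤-total m n of λ where
    (inj₁ m≤n) → ≤N⇒≡ m≤n (subst (n <_) q∸1≡N n<) eq
    (inj₂ n≤m) → sym (≤N⇒≡ n≤m (subst (m <_) q∸1≡N m<) (sym eq))

  log : ∀ {x} → x ≢ 0# → ∃ λ n → x ≡ pow g n
  log = proj₂ gen _

  x^[q∸1]≡1 : ∀ {x} → x ≢ 0# → pow x (q ∸ 1) ≡ 1#
  x^[q∸1]≡1 {x} x≢0 with log x≢0
  ... | n , refl = trans (sym (pow-* g n (q ∸ 1))) (trans (cong (pow g) (ℕₚ.*-comm n _)) (pow-*-1 (q ∸ 1) n pow-g-[q∸1]))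

  Commutes : Carrier → (Carrier → Carrier) → Set
  Commutes k θ = ∀ x → θ (k * x) ≡ k * θ x

  -- Multiplication by `pow g k` preserves each class of exponents mod k, and on a class the map is
  -- multiplication by a constant.
  cyclotomic⇒commutes : ∀ k → .{{_ : NonZero k}} → ∀ {θ} → IsCyclotomicMap g k θ → Commutes (pow g k) θ
  cyclotomic⇒commutes k {θ} (θ0≡0 , a , θ≡a) x with x ≟ 0#
  ... | yes refl = trans (cong θ (zeroʳ _)) (trans θ0≡0 (sym (trans (cong (pow g k *_) θ0≡0) (zeroʳ _))))
  ... | no x≢0 with log x≢0
  ...   | j , refl = begin
    θ (pow g k * pow g j)            ≡⟨ θ≡a i _ (j ℕ.+ k , trans (ℕ.[m+n]%n≡m%n j k) j%k≡i , trans (*-comm _ _) (sym (pow-+ g j k))) ⟩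
    a i * (pow g k * pow g j)        ≡⟨ solve 3 (λ a u v → a :* (u :* v) := u :* (a :* v)) refl (a i) _ _ ⟩
    pow g k * (a i * pow g j)        ≡⟨ cong (pow g k *_) (θ≡a i _ (j , j%k≡i , refl)) ⟨
    pow g k * θ (pow g j)            ∎
    where
    open ≡-Reasoning
    i : Fin k
    i = j ℕ.mod k
    j%k≡i : j ℕ.% k ≡ toℕ i
    j%k≡i = sym (Fin.toℕ-fromℕ< _)

  commutes-pow : ∀ {h θ} → Commutes h θ → ∀ n → Commutes (pow h n) θ
  commutes-pow {θ = θ} comm zero x = trans (cong θ (*-identityˡ x)) (sym (*-identityˡ _))
  commutes-pow {h} {θ} comm (suc n) x = begin
    θ (h * pow h n * x)      ≡⟨ cong θ (*-assoc _ _ _) ⟩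
    θ (h * (pow h n * x))    ≡⟨ comm _ ⟩
    h * θ (pow h n * x)      ≡⟨ cong (h *_) (commutes-pow comm n x) ⟩
    h * (pow h n * θ x)      ≡⟨ *-assoc _ _ _ ⟨
    h * pow h n * θ x        ∎
    where open ≡-Reasoning

  -- The multipliers are read off at the representatives gⁱ with i < k. Division of the exponent by
  -- k reaches the rest of each class from its representative by powers of `pow g k`, with which θ
  -- commutes.
  commutes⇒cyclotomic : ∀ k → .{{_ : NonZero k}} → ∀ {θ} → θ 0# ≡ 0# → Commutes (pow g k) θ → IsCyclotomicMap g k θ
  commutes⇒cyclotomic k {θ} θ0≡0 comm = θ0≡0 , a , λ { i _ (j , j%k≡i , refl) → begin
    θ (pow g j)                                      ≡⟨ cong θ (split j) ⟩
    θ (c j * pow g (j ℕ.% k))                        ≡⟨ commutes-pow comm (j ℕ./ k) _ ⟩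
    c j * θ (pow g (j ℕ.% k))                        ≡⟨ cong (λ r → c j * θ (pow g r)) j%k≡i ⟩
    c j * θ (pow g (toℕ i))                          ≡⟨ cong (c j *_) (a-spec i) ⟩
    c j * (a i * pow g (toℕ i))                      ≡⟨ solve 3 (λ a u v → u :* (a :* v) := a :* (u :* v)) refl (a i) _ _ ⟩
    a i * (c j * pow g (toℕ i))                      ≡⟨ cong (λ r → a i * (c j * pow g r)) j%k≡i ⟨
    a i * (c j * pow g (j ℕ.% k))                    ≡⟨ cong (a i *_) (split j) ⟨
    a i * pow g j                                    ∎ }
    where
    open ≡-Reasoning
    c : ℕ → Carrier
    c j = pow (pow g k) (j ℕ./ k)
    split : ∀ j → pow g j ≡ c j * pow g (j ℕ.% k)
    split j = begin
      pow g j                                      ≡⟨ cong (pow g) (ℕ.m≡m%n+[m/n]*n j k) ⟩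
      pow g (j ℕ.% k ℕ.+ j ℕ./ k ℕ.* k)            ≡⟨ pow-+ g (j ℕ.% k) _ ⟩
      pow g (j ℕ.% k) * pow g (j ℕ./ k ℕ.* k)      ≡⟨ *-comm _ _ ⟩
      pow g (j ℕ./ k ℕ.* k) * pow g (j ℕ.% k)      ≡⟨ cong (_* pow g (j ℕ.% k)) (trans (cong (pow g) (ℕₚ.*-comm (j ℕ./ k) k)) (pow-* g k _)) ⟩
      c j * pow g (j ℕ.% k)                        ∎
    a : Fin k → Carrier
    a i = θ (pow g (toℕ i)) * pow-≢0 (toℕ i) g≢0 ⁻¹
    a-spec : ∀ i → θ (pow g (toℕ i)) ≡ a i * pow g (toℕ i)
    a-spec i = sym (trans (*-assoc _ _ _) (trans (cong (θ (pow g (toℕ i)) *_) (trans (*-comm _ _) (*-inverseʳ (pow-≢0 (toℕ i) g≢0)))) (*-identityʳ _)))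

-- From a seed to an orthomorphism orthogonal to a linear one.

module Seeds {q : ℕ} (F : FiniteField q) (g : FiniteField.Carrier F) (gen : FiniteField.IsGenerator F g) where
  open Cyclic F g gen public

  Solution : (d : ℕ) → .{{NonZero d}} → Set
  Solution d = Σ (Carrier → Carrier) λ θ → InD g d θ × Σ Carrier λ c → IsLinearMultiplier c × Orthogonal θ (λ x → c * x)

  Perturbs : (Carrier → Carrier) → Carrier → Set
  Perturbs η μ = ∀ {x y} → x + μ * η x ≡ y + μ * η y → x ≡ y

  -- The function η of the introduction, commuting exactly with the f-th roots of unity.
  record Seed (f : ℕ) : Set where
    field
      η : Carrier → Carrier
      η-0 : η 0# ≡ 0#
      η-commutes : ∀ k → pow k f ≡ 1# → Commutes k η
      η-exact : ∀ h → h ≢ 0# → Commutes h η → pow h f ≡ 1#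
      μ₁ μ₂ μ₃ : Carrier
      μ₁≢0 : μ₁ ≢ 0#
      μ₂≢0 : μ₂ ≢ 0#
      μ₃≢0 : μ₃ ≢ 0#
      μ₁≢μ₂ : μ₁ ≢ μ₂
      μ₁≢μ₃ : μ₁ ≢ μ₃
      μ₂≢μ₃ : μ₂ ≢ μ₃
      η-μ₁ : Perturbs η μ₁
      η-μ₂ : Perturbs η μ₂
      η-μ₃ : Perturbs η μ₃

  module FromSeed (d f : ℕ) .{{_ : NonZero d}} (q∸1≡fd : q ∸ 1 ≡ f ℕ.* d) (seed : Seed f) where
    open Seed seed

    private
      μ₂-μ₁≢0 = x≢y⇒x-y≢0 (μ₁≢μ₂ ∘ sym)

      -- These solve a linear system. Proportionality of a (x + μ₁ η) - x to x + μ₂ η forces a = μ₂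
      -- / (μ₂ - μ₁), and proportionality of a (x + μ₁ η) - c x to x + μ₃ η forces c = a (μ₃ - μ₁) /
      -- μ₃.
      w r a c : Carrier
      w = μ₂-μ₁≢0 ⁻¹
      r = μ₃≢0 ⁻¹
      a = μ₂ * w
      c = μ₂ * w * ((μ₃ - μ₁) * r)

      θ : Carrier → Carrier
      θ x = a * (x + μ₁ * η x)

      w-spec : (μ₂ - μ₁) * w ≡ 1#
      w-spec = *-inverseʳ μ₂-μ₁≢0

      r-spec : μ₃ * r ≡ 1#
      r-spec = *-inverseʳ μ₃≢0

      ⁻¹-≢0 : ∀ {x y} → x * y ≡ 1# → y ≢ 0#
      ⁻¹-≢0 eq = *≡1⇒≢0 (trans (*-comm _ _) eq)

      a≢0 : a ≢ 0#
      a≢0 = *-≢0 μ₂≢0 (⁻¹-≢0 w-spec)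

      θ-id : ∀ x → θ x - x ≡ μ₁ * w * (x + μ₂ * η x)
      θ-id x = begin
        μ₂ * w * (x + μ₁ * η x) - x                        ≡⟨ cong (λ u → μ₂ * w * (x + μ₁ * η x) - u) (*-identityˡ x) ⟨
        μ₂ * w * (x + μ₁ * η x) - 1# * x                   ≡⟨ cong (λ u → μ₂ * w * (x + μ₁ * η x) - u * x) w-spec ⟨
        μ₂ * w * (x + μ₁ * η x) - (μ₂ - μ₁) * w * x        ≡⟨ solve 5 (λ m n w x e → n :* w :* (x :+ m :* e) :- (n :- m) :* w :* x := m :* w :* (x :+ n :* e)) refl μ₁ μ₂ w x (η x) ⟩
        μ₁ * w * (x + μ₂ * η x)                            ∎
        where open ≡-Reasoning

      θ-c : ∀ x → θ x - c * x ≡ μ₁ * μ₂ * w * r * (x + μ₃ * η x)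
      θ-c x = begin
        μ₂ * w * (x + μ₁ * η x) - c * x
          ≡⟨ solve 3 (λ u v s → u :* v :- s := con (ℤ.+ 1) :* (u :* v) :- s) refl (μ₂ * w) (x + μ₁ * η x) (c * x) ⟩
        1# * (μ₂ * w * (x + μ₁ * η x)) - c * x
          ≡⟨ cong (λ u → u * (μ₂ * w * (x + μ₁ * η x)) - c * x) r-spec ⟨
        μ₃ * r * (μ₂ * w * (x + μ₁ * η x)) - μ₂ * w * ((μ₃ - μ₁) * r) * x
          ≡⟨ solve 7 (λ m n l w r x e → l :* r :* (n :* w :* (x :+ m :* e)) :- n :* w :* ((l :- m) :* r) :* x
                := m :* n :* w :* r :* (x :+ l :* e)) refl μ₁ μ₂ μ₃ w r x (η x) ⟩
        μ₁ * μ₂ * w * r * (x + μ₃ * η x) ∎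
        where open ≡-Reasoning

      scaled : ∀ {μ s ψ} → Perturbs η μ → s ≢ 0# → (∀ x → ψ x ≡ s * (x + μ * η x)) → IsPermutation ψ
      scaled inj s≢0 ψ≡ = injective⇒permutation λ {x} {y} eq →
        inj (*-cancelˡ s≢0 (trans (sym (ψ≡ x)) (trans eq (ψ≡ y))))

      -- The value 0 is excluded by μ₁ ≠ μ₃. The value 1 is excluded by μ₂ ≠ μ₃, because c - 1 = μ₁
      -- (μ₃ - μ₂) / ((μ₂ - μ₁) μ₃).
      c-multiplier : IsLinearMultiplier c
      c-multiplier = *-≢0 a≢0 (*-≢0 (x≢y⇒x-y≢0 (μ₁≢μ₃ ∘ sym)) (⁻¹-≢0 r-spec)) , λ c≡1 →
        *-≢0 (*-≢0 μ₁≢0 (⁻¹-≢0 w-spec)) (*-≢0 (x≢y⇒x-y≢0 (μ₂≢μ₃ ∘ sym)) (⁻¹-≢0 r-spec)) (begin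
          μ₁ * w * ((μ₃ - μ₂) * r)
            ≡⟨ solve 5 (λ m n l w r → m :* w :* ((l :- n) :* r) := n :* w :* ((l :- m) :* r) :- (n :- m) :* w :* (l :* r)) refl μ₁ μ₂ μ₃ w r ⟩
          c - (μ₂ - μ₁) * w * (μ₃ * r)   ≡⟨ cong₂ _-_ c≡1 (cong₂ _*_ w-spec r-spec) ⟩
          1# - 1# * 1#                   ≡⟨ cong (λ u → 1# - u) (*-identityˡ 1#) ⟩
          1# - 1#                        ≡⟨ -‿inverseʳ 1# ⟩
          0#                             ∎)
        where open ≡-Reasoning

      θ-commutes : ∀ {h} → Commutes h η → Commutes h θ
      θ-commutes {h} comm x = trans (cong (λ e → a * (h * x + μ₁ * e)) (comm x))
        (solve 5 (λ a h x m e → a :* (h :* x :+ m :* (h :* e)) := h :* (a :* (x :+ m :* e))) refl a h x μ₁ (η x))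

      η-commutes-back : ∀ {h} → Commutes h θ → Commutes h η
      η-commutes-back {h} comm x = *-cancelˡ μ₁≢0 (begin
        μ₁ * η (h * x)                          ≡⟨ solve 2 (λ u v → v := u :+ v :- u) refl (h * x) _ ⟩
        h * x + μ₁ * η (h * x) - h * x          ≡⟨ cong (_- h * x) (*-cancelˡ a≢0 (trans (comm x)
                                                     (solve 3 (λ h a z → h :* (a :* z) := a :* (h :* z)) refl h a _))) ⟩
        h * (x + μ₁ * η x) - h * x              ≡⟨ solve 4 (λ h x m e → h :* (x :+ m :* e) :- h :* x := m :* (h :* e)) refl h x μ₁ (η x) ⟩
        μ₁ * (h * η x)                          ∎)
        where open ≡-Reasoning

      θ-0 : θ 0# ≡ 0#
      θ-0 = trans (cong (λ e → a * (0# + μ₁ * e)) η-0) (solve 2 (λ a m → a :* (con (ℤ.+ 0) :+ m :* con (ℤ.+ 0)) := con (ℤ.+ 0)) refl a μ₁)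

      f≢0 : f ≢ 0
      f≢0 refl = ℕₚ.n≮n 0 (subst (0 <_) q∸1≡fd 0<q∸1)

      -- Exactness of η turns commutation with gˡ, for l = `ℓ`, into g^(l f) = 1. Hence f d divides
      -- l f, so d divides l, which is too small.
      minimal : ∀ ℓ → .{{NonZero ℓ}} → ℓ < d → ¬ Commutes (pow g ℓ) θ
      minimal ℓ ℓ<d comm = ℕₚ.<⇒≱ ℓ<d (∣⇒≤ (*-cancelʳ-∣ f {{ℕ.≢-nonZero f≢0}}
        (subst (_∣ ℓ ℕ.* f) (trans q∸1≡fd (ℕₚ.*-comm f d)) (pow-g≡1⇒∣ _
          (trans (pow-* g ℓ f) (η-exact _ (pow-≢0 ℓ g≢0) (η-commutes-back comm)))))))

    solution : Solution d
    solution = θ , ((commutes⇒cyclotomic d θ-0 (θ-commutes (η-commutes _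
                      (trans (sym (pow-* g d f)) (trans (cong (pow g) (trans (ℕₚ.*-comm d f) (sym q∸1≡fd))) pow-g-[q∸1]))))
                    , scaled η-μ₁ a≢0 (λ x → refl)
                    , scaled η-μ₂ (*-≢0 μ₁≢0 (⁻¹-≢0 w-spec)) θ-id)
                   , λ ℓ ℓ<d _ inC → minimal ℓ ℓ<d (cyclotomic⇒commutes ℓ (proj₁ inC)))
             , c , c-multiplier
             , scaled η-μ₃ (*-≢0 (*-≢0 (*-≢0 μ₁≢0 μ₂≢0) (⁻¹-≢0 w-spec)) (⁻¹-≢0 r-spec)) θ-c

-- Seeds supported on the multiples of one translated set.

module CosetTrades {q : ℕ} (F : FiniteField q) (g : FiniteField.Carrier F) (gen : FiniteField.IsGenerator F g) where
  open Seeds F g gen public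

  -- The value x + μ η(x) determines u η(x) on applying η, hence η(x), and hence x by subtraction.
  perturbs : ∀ {η μ u} → u ≢ 0# → (∀ x → η (x + μ * η x) ≡ u * η x) → Perturbs η μ
  perturbs {η} {μ} {u} u≢0 scales {x} {y} eq = begin
    x                              ≡⟨ solve 2 (λ x e → x := x :+ e :- e) refl x (μ * η x) ⟩
    x + μ * η x - μ * η x          ≡⟨ cong₂ (λ a b → a - μ * b) eq (*-cancelˡ u≢0 (trans (sym (scales x)) (trans (cong η eq) (scales y)))) ⟩
    y + μ * η y - μ * η y          ≡⟨ solve 2 (λ x e → x := x :+ e :- e) refl y (μ * η y) ⟨
    y                              ∎
    where open ≡-Reasoning

  -- y ↦ y + μ ε(y) maps U to itself and scales ε, which makes x ↦ x + μ η(x) injective below.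
  record Shift (U : Carrier → Set) (ε : Carrier → Carrier) : Set where
    field
      μ u : Carrier
      μ≢0 : μ ≢ 0#
      u≢0 : u ≢ 0#
      closed : ∀ {y} → U y → U (y + μ * ε y)
      scales : ∀ {y} → U y → ε (y + μ * ε y) ≡ u * ε y
  open Shift

  -- η will carry the pattern ε, placed on t + U, to all sets k (t + U) with k an f-th root of
  -- unity. These sets may overlap; `compatible` says that ε agrees on overlaps.
  module CosetTrade
    (f : ℕ) (t : Carrier) (U : Carrier → Set) (U? : Decidable U) (ε : Carrier → Carrier)
    (compatible : ∀ k {y y′} → pow k f ≡ 1# → U y → U y′ → k * (t + y) ≡ t + y′ → k * ε y ≡ ε y′)
    (avoids-0 : ∀ {y} → U y → t + y ≢ 0#)
    where

    record Moved (x : Carrier) : Set where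
      constructor moved
      field
        k : Carrier
        y : Carrier
        k^f≡1 : pow k f ≡ 1#
        y∈U : U y
        x≡k[t+y] : x ≡ k * (t + y)

    private
      abstract
        inverse-root : ∀ {k} → pow k f ≡ 1# → f ≢ 0 → ∃ λ m → m * k ≡ 1# × pow m f ≡ 1#
        inverse-root {k} k^f≡1 f≢0 = m , mk≡1 , (begin
          pow m f                ≡⟨ *-identityʳ _ ⟨
          pow m f * 1#           ≡⟨ cong (pow m f *_) k^f≡1 ⟨
          pow m f * pow k f      ≡⟨ pow-distrib-* m k f ⟨
          pow (m * k) f          ≡⟨ trans (cong (λ z → pow z f) mk≡1) (pow-1 f) ⟩
          1#                     ∎)
          where
          open ≡-Reasoning
          k≢0 : k ≢ 0#
          k≢0 = pow≡1⇒≢0 f f≢0 k^f≡1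
          m : Carrier
          m = k≢0 ⁻¹
          mk≡1 : m * k ≡ 1#
          mk≡1 = trans (*-comm _ _) (*-inverseʳ k≢0)

        moved? : Decidable Moved
        moved? x with ∃? (λ k → ∃? (λ y → (pow k f ≟ 1#) ×-dec U? y ×-dec (x ≟ k * (t + y))))
        ... | yes (k , y , k^f , y∈U , eq) = yes (moved k y k^f y∈U eq)
        ... | no none = no λ (moved k y k^f y∈U eq) → none (k , y , k^f , y∈U , eq)

    -- The value does not depend on the representation x = k (t + y), by compatibility.
    η : Carrier → Carrier
    η x with moved? x
    ... | yes (moved k y _ _ _) = k * ε y
    ... | no _ = 0#

    module _ (f≢0 : f ≢ 0) where

      η-moved : ∀ {k y} → pow k f ≡ 1# → U y → η (k * (t + y)) ≡ k * ε y
      η-moved {k} {y} k^f y∈U with moved? (k * (t + y))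
      ... | no ¬m = contradiction (moved k y k^f y∈U refl) ¬m
      ... | yes (moved k′ y′ k′^f y′∈U eq) with inverse-root k^f f≢0
      ...   | m , mk≡1 , m^f = begin
        k′ * ε y′              ≡⟨ *-identityˡ _ ⟨
        1# * (k′ * ε y′)       ≡⟨ cong (_* (k′ * ε y′)) mk≡1 ⟨
        m * k * (k′ * ε y′)    ≡⟨ solve 4 (λ m k l e → m :* k :* (l :* e) := k :* (m :* l :* e)) refl m k k′ (ε y′) ⟩
        -- The search may have returned another representation k′ (t + y′) of the same point. The
        -- f-th root of unity m k′ then takes t + y′ to t + y.
        k * (m * k′ * ε y′)    ≡⟨ cong (k *_) (compatible (m * k′) mk′^f y′∈U y∈U (begin
          m * k′ * (t + y′)      ≡⟨ *-assoc _ _ _ ⟩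
          m * (k′ * (t + y′))    ≡⟨ cong (m *_) eq ⟨
          m * (k * (t + y))      ≡⟨ *-assoc _ _ _ ⟨
          m * k * (t + y)        ≡⟨ cong (_* (t + y)) mk≡1 ⟩
          1# * (t + y)           ≡⟨ *-identityˡ _ ⟩
          t + y                  ∎)) ⟩
        k * ε y                ∎
        where
        open ≡-Reasoning
        mk′^f : pow (m * k′) f ≡ 1#
        mk′^f = trans (pow-distrib-* m k′ f) (trans (cong₂ _*_ m^f k′^f) (*-identityˡ 1#))

      η-unmoved : ∀ {x} → ¬ Moved x → η x ≡ 0#
      η-unmoved {x} ¬m with moved? x
      ... | yes m = contradiction m ¬m
      ... | no _ = refl

      η-commutes : ∀ k → pow k f ≡ 1# → Commutes k η
      η-commutes k k^f x = case moved? x of λ where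
          (yes (moved l y l^f y∈U refl)) → begin
            η (k * (l * (t + y)))    ≡⟨ cong η (*-assoc _ _ _) ⟨
            η (k * l * (t + y))      ≡⟨ η-moved (trans (pow-distrib-* k l f) (trans (cong₂ _*_ k^f l^f) (*-identityˡ 1#))) y∈U ⟩
            k * l * ε y              ≡⟨ *-assoc _ _ _ ⟩
            k * (l * ε y)            ≡⟨ cong (k *_) (η-moved l^f y∈U) ⟨
            k * η (l * (t + y))      ∎
          (no ¬m) → trans
            (η-unmoved λ (moved l y l^f y∈U eq) → ¬m (
              let m , mk≡1 , m^f = inverse-root k^f f≢0 in
              moved (m * l) y (trans (pow-distrib-* m l f) (trans (cong₂ _*_ m^f l^f) (*-identityˡ 1#))) y∈U (begin
                x                    ≡⟨ *-identityˡ _ ⟨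
                1# * x               ≡⟨ cong (_* x) mk≡1 ⟨
                m * k * x            ≡⟨ *-assoc _ _ _ ⟩
                m * (k * x)          ≡⟨ cong (m *_) eq ⟩
                m * (l * (t + y))    ≡⟨ *-assoc _ _ _ ⟨
                m * l * (t + y)      ∎)))
            (sym (trans (cong (k *_) (η-unmoved ¬m)) (zeroʳ k)))
        where open ≡-Reasoning

      -- On k (t + U) the perturbed point is k (t + (y + μ ε(y))), which lies in the same set; a
      -- point outside all these sets is fixed, and η vanishes there. So η is scaled by u everywhere
      -- and `perturbs` applies.
      η-shift : (s : Shift U ε) → Perturbs η (μ s)
      η-shift s = perturbs (u≢0 s) λ x → case moved? x of λ where
          (yes (moved k y k^f y∈U refl)) → begin
            η (k * (t + y) + μ s * η (k * (t + y)))  ≡⟨ cong (λ e → η (k * (t + y) + μ s * e)) (η-moved k^f y∈U) ⟩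
            η (k * (t + y) + μ s * (k * ε y))        ≡⟨ cong η (solve 5 (λ k t y m e → k :* (t :+ y) :+ m :* (k :* e) := k :* (t :+ (y :+ m :* e))) refl k t y (μ s) (ε y)) ⟩
            η (k * (t + (y + μ s * ε y)))            ≡⟨ η-moved k^f (closed s y∈U) ⟩
            k * ε (y + μ s * ε y)                    ≡⟨ cong (k *_) (scales s y∈U) ⟩
            k * (u s * ε y)                          ≡⟨ solve 3 (λ k u e → k :* (u :* e) := u :* (k :* e)) refl k (u s) (ε y) ⟩
            u s * (k * ε y)                          ≡⟨ cong (u s *_) (η-moved k^f y∈U) ⟨
            u s * η (k * (t + y))                    ∎
          (no ¬m) → trans (cong η (trans (cong (λ e → x + μ s * e) (η-unmoved ¬m)) (solve 2 (λ x m → x :+ m :* con (ℤ.+ 0) := x) refl x (μ s))))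
            (trans (η-unmoved ¬m) (sym (trans (cong (u s *_) (η-unmoved ¬m)) (zeroʳ _))))
        where open ≡-Reasoning

      η-0 : η 0# ≡ 0#
      η-0 = η-unmoved λ (moved k y k^f y∈U eq) → case inverse-root k^f f≢0 of λ where
          (m , mk≡1 , _) → avoids-0 y∈U (begin
            t + y               ≡⟨ *-identityˡ _ ⟨
            1# * (t + y)        ≡⟨ cong (_* (t + y)) mk≡1 ⟨
            m * k * (t + y)     ≡⟨ *-assoc _ _ _ ⟩
            m * (k * (t + y))   ≡⟨ cong (m *_) eq ⟨
            m * 0#              ≡⟨ zeroʳ m ⟩
            0#                  ∎)
        where open ≡-Reasoning

      -- Exactness is tested at the single point t + y₀. If h commutes with η, then h (t + y₀) has a
      -- nonzero value of η and so is some k (t + y) with matching value; `rigid` must conclude from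
      -- this that h is an f-th root of unity.
      seed : (s₁ s₂ s₃ : Shift U ε) → μ s₁ ≢ μ s₂ → μ s₁ ≢ μ s₃ → μ s₂ ≢ μ s₃ →
        ∀ {y₀} → U y₀ → ε y₀ ≢ 0# →
        (∀ h k y → pow k f ≡ 1# → U y → h * (t + y₀) ≡ k * (t + y) → h * ε y₀ ≡ k * ε y → pow h f ≡ 1#) → Seed f
      seed s₁ s₂ s₃ ≢₁₂ ≢₁₃ ≢₂₃ {y₀} y₀∈U εy₀≢0 rigid = record
        { η = η ; η-0 = η-0 ; η-commutes = η-commutes
        ; μ₁ = μ s₁ ; μ₂ = μ s₂ ; μ₃ = μ s₃
        ; μ₁≢0 = μ≢0 s₁ ; μ₂≢0 = μ≢0 s₂ ; μ₃≢0 = μ≢0 s₃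
        ; μ₁≢μ₂ = ≢₁₂ ; μ₁≢μ₃ = ≢₁₃ ; μ₂≢μ₃ = ≢₂₃
        ; η-μ₁ = η-shift s₁ ; η-μ₂ = η-shift s₂ ; η-μ₃ = η-shift s₃
        ; η-exact = exact }
        where
        open ≡-Reasoning
        η-base : η (t + y₀) ≡ ε y₀
        η-base = trans (cong η (sym (*-identityˡ _))) (trans (η-moved (pow-1 f) y₀∈U) (*-identityˡ _))
        exact : ∀ h → h ≢ 0# → Commutes h η → pow h f ≡ 1#
        exact h h≢0 comm = case moved? (h * (t + y₀)) of λ where
          (yes (moved k y k^f y∈U eq)) → rigid h k y k^f y∈U eq (begin
            h * ε y₀             ≡⟨ cong (h *_) η-base ⟨
            h * η (t + y₀)       ≡⟨ comm _ ⟨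
            η (h * (t + y₀))     ≡⟨ cong η eq ⟩
            η (k * (t + y))      ≡⟨ η-moved k^f y∈U ⟩
            k * ε y              ∎)
          (no ¬m) → contradiction (begin
            h * ε y₀             ≡⟨ cong (h *_) η-base ⟨
            h * η (t + y₀)       ≡⟨ comm _ ⟨
            η (h * (t + y₀))     ≡⟨ η-unmoved ¬m ⟩
            0#                   ∎) (*-≢0 h≢0 εy₀≢0)

-- Infinite families of seeds.

module SeedFamilies {q : ℕ} (F : FiniteField q) (g : FiniteField.Carrier F) (gen : FiniteField.IsGenerator F g) where
  open CosetTrades F g gen public
  open ≡-Reasoning

  abstract
    -- Otherwise a choice of preimages would inject the q field elements into `Fin m`.
    outside-image : ∀ {m} (f : Fin m → Carrier) → m < q → ∃ λ t → ∀ i → f i ≢ t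
    outside-image f m<q with ∃? (λ t → ¬? (Fin.any? (λ i → f i ≟ t)))
    ... | yes (t , ¬hit) = t , λ i eq → ¬hit (i , eq)
    ... | no ¬miss = contradiction (Fin.injective⇒≤ {f = λ i → proj₁ (hit (card.from i))} (λ {i} {j} eq → begin
        i                                         ≡⟨ card.strictlyInverseˡ i ⟨
        card.to (card.from i)                     ≡⟨ cong card.to (proj₂ (hit (card.from i))) ⟨
        card.to (f (proj₁ (hit (card.from i))))   ≡⟨ cong (card.to ∘ f) eq ⟩
        card.to (f (proj₁ (hit (card.from j))))   ≡⟨ cong card.to (proj₂ (hit (card.from j))) ⟩
        card.to (card.from j)                     ≡⟨ card.strictlyInverseˡ j ⟩
        j                                         ∎)) (ℕₚ.<⇒≱ m<q)
      where
      hit : ∀ t → ∃ λ i → f i ≡ t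
      hit t = decidable-stable (Fin.any? (λ i → f i ≟ t)) (λ ¬hit → ¬miss (t , ¬hit))

  module Roots (n e : ℕ) (q∸1≡ne : q ∸ 1 ≡ n ℕ.* e) where

    -- A primitive n-th root of unity, since `g` has order n e.
    ζ : Carrier
    ζ = pow g e

    0<ne : 0 < n ℕ.* e
    0<ne = subst (0 <_) q∸1≡ne 0<q∸1

    n≢0 : n ≢ 0
    n≢0 refl = ℕₚ.n≮n 0 0<ne

    e≢0 : e ≢ 0
    e≢0 refl = ℕₚ.n≮n 0 (subst (0 <_) (ℕₚ.*-zeroʳ n) 0<ne)

    instance
      n-nonZero : NonZero n
      n-nonZero = ℕ.≢-nonZero n≢0
      e-nonZero : NonZero e
      e-nonZero = ℕ.≢-nonZero e≢0

    ζ^n≡1 : pow ζ n ≡ 1#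
    ζ^n≡1 = trans (sym (pow-* g e n)) (trans (cong (pow g) (trans (ℕₚ.*-comm e n) (sym q∸1≡ne))) pow-g-[q∸1])

    ζ^i^n≡1 : ∀ i → pow (pow ζ i) n ≡ 1#
    ζ^i^n≡1 i = trans (sym (pow-* ζ i n)) (trans (cong (pow ζ) (ℕₚ.*-comm i n)) (pow-*-1 n i ζ^n≡1))

    ζ^-injective : ∀ {i j} → i < n → j < n → pow ζ i ≡ pow ζ j → i ≡ j
    ζ^-injective {i} {j} i<n j<n eq = ℕₚ.*-cancelˡ-≡ i j e
      (pow-g-injective (bound i<n) (bound j<n) (trans (pow-* g e i) (trans eq (sym (pow-* g e j)))))
      where
      bound : ∀ {i} → i < n → e ℕ.* i < q ∸ 1
      bound {i} i<n = subst (e ℕ.* i <_) (trans (ℕₚ.*-comm e n) (sym q∸1≡ne)) (ℕₚ.*-monoʳ-< e i<n)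

    root≢0 : ∀ {y} → pow y n ≡ 1# → y ≢ 0#
    root≢0 = pow≡1⇒≢0 n n≢0

    -- For y = gʲ the relation g^(j n) = 1 says that n e divides j n, so e divides j and y is a
    -- power of ζ.
    root : ∀ {y} → pow y n ≡ 1# → ∃ λ i → i < n × y ≡ pow ζ i
    root {y} y^n with log (root≢0 y^n)
    ... | j , refl with *-cancelʳ-∣ {e} {j} n (subst (_∣ j ℕ.* n) (trans q∸1≡ne (ℕₚ.*-comm n e)) (pow-g≡1⇒∣ _ (trans (pow-* g j n) y^n)))
    ...   | divides i refl = i ℕ.% n , ℕ.m%n<n i n , (begin
      pow g (i ℕ.* e)                               ≡⟨ cong (pow g) (ℕₚ.*-comm i e) ⟩
      pow g (e ℕ.* i)                               ≡⟨ pow-* g e i ⟩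
      pow ζ i                                       ≡⟨ cong (pow ζ) (ℕ.m≡m%n+[m/n]*n i n) ⟩
      pow ζ (i ℕ.% n ℕ.+ i ℕ./ n ℕ.* n)             ≡⟨ pow-+ ζ (i ℕ.% n) _ ⟩
      pow ζ (i ℕ.% n) * pow ζ (i ℕ./ n ℕ.* n)       ≡⟨ cong (λ m → pow ζ (i ℕ.% n) * pow ζ m) (ℕₚ.*-comm (i ℕ./ n) n) ⟩
      pow ζ (i ℕ.% n) * pow ζ (n ℕ.* (i ℕ./ n))     ≡⟨ cong (pow ζ (i ℕ.% n) *_) (pow-*-1 n (i ℕ./ n) ζ^n≡1) ⟩
      pow ζ (i ℕ.% n) * 1#                          ≡⟨ *-identityʳ _ ⟩
      pow ζ (i ℕ.% n)                               ∎)

    -- With μ = ζⁱ - 1 the shift y + μ y is multiplication by ζⁱ, which preserves the group of n-th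
    -- roots of unity.
    rotation : ∀ i → i < n → 0 < i → Shift (λ y → pow y n ≡ 1#) id
    rotation i i<n 0<i = record
      { μ = pow ζ i - 1#
      ; u = pow ζ i
      ; μ≢0 = x≢y⇒x-y≢0 λ eq → ℕₚ.<⇒≢ 0<i (ζ^-injective (ℕₚ.<-trans 0<i i<n) i<n (sym eq))
      ; u≢0 = root≢0 (ζ^i^n≡1 i)
      ; closed = λ {y} y^n → trans (cong (λ z → pow z n) (times y)) (trans (pow-distrib-* _ y n)
          (trans (cong₂ _*_ (ζ^i^n≡1 i) y^n) (*-identityˡ 1#)))
      ; scales = λ {y} _ → times y }
      where
      times : ∀ y → y + (pow ζ i - 1#) * y ≡ pow ζ i * y
      times y = solve 2 (λ u y → y :+ (u :- con (ℤ.+ 1)) :* y := u :* y) refl (pow ζ i) y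

    rotations-distinct : ∀ {i j} → i < n → j < n → i ≢ j → pow ζ i - 1# ≢ pow ζ j - 1#
    rotations-distinct i<n j<n i≢j eq = i≢j (ζ^-injective i<n j<n (begin
      _                  ≡⟨ solve 1 (λ u → u := u :- con (ℤ.+ 1) :+ con (ℤ.+ 1)) refl _ ⟩
      _ - 1# + 1#        ≡⟨ cong (_+ 1#) eq ⟩
      _ - 1# + 1#        ≡⟨ solve 1 (λ u → u := u :- con (ℤ.+ 1) :+ con (ℤ.+ 1)) refl _ ⟨
      _                  ∎))

    -- Four roots of unity supply three nontrivial rotations and hence three values of μ. The base
    -- point is y₀ = 1, and subtracting h = k y from h (t + 1) = k (t + y) brings the rigidity
    -- condition to the form required here.
    rotationSeed : 4 ≤ n → ∀ f → f ≢ 0 → ∀ t →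
      (∀ k {y y′} → pow k f ≡ 1# → pow y n ≡ 1# → pow y′ n ≡ 1# → k * (t + y) ≡ t + y′ → k * y ≡ y′) →
      (∀ {y} → pow y n ≡ 1# → t + y ≢ 0#) →
      (∀ h k y → pow k f ≡ 1# → pow y n ≡ 1# → h * t ≡ k * t → h ≡ k * y → pow h f ≡ 1#) →
      Seed f
    rotationSeed 4≤n f f≢0 t compatible avoids-0 rigid =
      CosetTrade.seed f t (λ y → pow y n ≡ 1#) (λ y → pow y n ≟ 1#) id compatible avoids-0 f≢0
        (rotation 1 1< z<s) (rotation 2 2< z<s) (rotation 3 4≤n z<s)
        (rotations-distinct 1< 2< λ ()) (rotations-distinct 1< 4≤n λ ()) (rotations-distinct 2< 4≤n λ ())
        (pow-1 n) 1≢0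
        λ h k y k^f y^n eq h*1≡ky → rigid h k y k^f y^n (begin
          h * t                               ≡⟨ solve 2 (λ h t → h :* t := h :* (t :+ con (ℤ.+ 1)) :- h :* con (ℤ.+ 1)) refl h t ⟩
          h * (t + 1#) - h * 1#               ≡⟨ cong₂ _-_ eq h*1≡ky ⟩
          k * (t + y) - k * y                 ≡⟨ solve 3 (λ k t y → k :* (t :+ y) :- k :* y := k :* t) refl k t y ⟩
          k * t                               ∎)
          (trans (sym (*-identityʳ h)) h*1≡ky)
      where
      2< : 2 < n
      2< = ℕₚ.<-trans (ℕₚ.n<1+n 2) 4≤n
      1< : 1 < n
      1< = ℕₚ.<-trans (ℕₚ.n<1+n 1) 2<

  -- Both groups are the f-th roots of unity H and t = 0, so η is the identity on H and 0 elsewhere.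
  -- Rigidity holds as h = k y is a product of elements of H.
  subgroupSeed : ∀ f d → q ∸ 1 ≡ f ℕ.* d → 4 ≤ f → Seed f
  subgroupSeed f d q∸1≡fd 4≤f = rotationSeed 4≤f f n≢0 0#
    (λ k _ _ _ eq → trans (cong (k *_) (sym (+-identityˡ _))) (trans eq (+-identityˡ _)))
    (λ y^f eq → root≢0 y^f (trans (sym (+-identityˡ _)) eq))
    (λ h k y k^f y^f _ h≡ky → trans (cong (λ z → pow z f) h≡ky) (trans (pow-distrib-* k y f) (trans (cong₂ _*_ k^f y^f) (*-identityˡ 1#))))
    where open Roots f d q∸1≡fd

  -- The group is that of the nonzero squares. With f = 1 there is just one translate, so it only
  -- has to avoid 0; it does for t = -g because the generator `g` is not a square.
  oddSeed : ∀ n → q ∸ 1 ≡ n ℕ.* 2 → 4 ≤ n → Seed 1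
  oddSeed n q∸1≡2n 4≤n = rotationSeed 4≤n 1 (λ ()) (- g)
    (λ k {y} k^1 _ _ eq → let k≡1 = trans (sym (*-identityʳ k)) k^1 in begin
      k * y                            ≡⟨ cong (_* y) k≡1 ⟩
      1# * y                           ≡⟨ solve 2 (λ t y → con (ℤ.+ 1) :* y := con (ℤ.+ 1) :* (t :+ y) :- t) refl (- g) y ⟩
      1# * (- g + y) - - g             ≡⟨ cong (λ z → z * (- g + y) - - g) k≡1 ⟨
      k * (- g + y) - - g              ≡⟨ cong (_- - g) eq ⟩
      - g + _ - - g                    ≡⟨ solve 2 (λ t y → t :+ y :- t := y) refl (- g) _ ⟩
      _                                ∎)
    (λ {y} y^n eq → nonresidue (trans (cong (λ z → pow z n) (begin
      g                 ≡⟨ +-identityʳ g ⟨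
      g + 0#            ≡⟨ cong (g +_) eq ⟨
      g + (- g + y)     ≡⟨ solve 2 (λ g y → g :+ (:- g :+ y) := y) refl g y ⟩
      y                 ∎)) y^n))
    (λ h k y k^1 _ ht≡kt _ → trans (cong (_* 1#) (*-cancelʳ (-‿≢0 g≢0) ht≡kt)) k^1)
    where
    open Roots n 2 q∸1≡2n
    nonresidue : pow g n ≢ 1#
    nonresidue eq = >⇒∤ (subst (n <_) (sym q∸1≡2n) (ℕₚ.m<m*n n 2 (s<s z<s))) (pow-g≡1⇒∣ n eq)

  -- For f ≤ 3 every nontrivial f-th root of unity is κ or its inverse, so the translates are
  -- disjoint once κ (t + y) = t + y′ is never satisfied. This forbids at most n² values of t.
  -- Excluding also t = 0 gives rigidity, as h t = k t then implies h = k; the bound on q leaves a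
  -- value over.
  translatedSubgroupSeed : ∀ f d n e → q ∸ 1 ≡ f ℕ.* d → q ∸ 1 ≡ n ℕ.* e →
    1 < f → f ≤ 3 → 4 ≤ n → suc (n ℕ.* n) < q → Seed f
  translatedSubgroupSeed f d n e q∸1≡fd q∸1≡ne 1<f f≤3 4≤n 1+n²<q =
    N.rotationSeed 4≤n f H.n≢0 t compatible
      -- If t + y were 0, then κ (t + y) = t + y would be a clash of y with itself.
      (λ y^n eq → clash y^n y^n (trans (cong (κ *_) eq) (trans (zeroʳ κ) (sym eq))))
      (λ h k y k^f _ ht≡kt _ → trans (cong (λ z → pow z f) (*-cancelʳ t≢0 ht≡kt)) k^f)
    where
    module H = Roots f d q∸1≡fd
    module N = Roots n e q∸1≡ne
    κ : Carrier
    κ = H.ζ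

    1-κ≢0 : 1# - κ ≢ 0#
    1-κ≢0 = x≢y⇒x-y≢0 λ eq → ℕₚ.0≢1+n (H.ζ^-injective {0} {1} (ℕₚ.<-trans z<s 1<f) 1<f (trans eq (sym (*-identityʳ κ))))

    r : Carrier
    r = 1-κ≢0 ⁻¹

    -- The solution t of κ (t + y) = t + y′ for y = ζⁱ and y′ = ζʲ.
    clashing : Fin n × Fin n → Carrier
    clashing (i , j) = (κ * pow N.ζ (toℕ i) - pow N.ζ (toℕ j)) * r

    forbidden : Fin (suc (n ℕ.* n)) → Carrier
    forbidden zero = 0#
    forbidden (suc ij) = clashing (remQuot {n} n ij)

    t : Carrier
    t = proj₁ (outside-image forbidden 1+n²<q)

    t-allowed : ∀ i → forbidden i ≢ t
    t-allowed = proj₂ (outside-image forbidden 1+n²<q)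

    t≢0 : t ≢ 0#
    t≢0 = t-allowed zero ∘ sym

    clash : ∀ {y y′} → pow y n ≡ 1# → pow y′ n ≡ 1# → κ * (t + y) ≢ t + y′
    clash {y} {y′} y^n y′^n eq with N.root y^n | N.root y′^n
    ... | i , i<n , refl | j , j<n , refl = t-allowed (suc (combine (fromℕ< i<n) (fromℕ< j<n))) (begin
      forbidden (suc (combine (fromℕ< i<n) (fromℕ< j<n)))  ≡⟨ forbidden-combine ⟩
      (κ * y - y′) * r                                     ≡⟨ cong (_* r) (solve 4 (λ κ t y z → κ :* y :- z := t :* (con (ℤ.+ 1) :- κ) :+ (κ :* (t :+ y) :- (t :+ z))) refl κ t y y′) ⟩
      (t * (1# - κ) + (κ * (t + y) - (t + y′))) * r        ≡⟨ cong (λ z → (t * (1# - κ) + (z - (t + y′))) * r) eq ⟩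
      (t * (1# - κ) + ((t + y′) - (t + y′))) * r           ≡⟨ solve 4 (λ κ t w r → (t :* (con (ℤ.+ 1) :- κ) :+ (w :- w)) :* r := t :* ((con (ℤ.+ 1) :- κ) :* r)) refl κ t (t + y′) r ⟩
      t * ((1# - κ) * r)                                   ≡⟨ cong (t *_) (*-inverseʳ 1-κ≢0) ⟩
      t * 1#                                               ≡⟨ *-identityʳ t ⟩
      t                                                    ∎)
      where
      forbidden-combine : forbidden (suc (combine (fromℕ< i<n) (fromℕ< j<n))) ≡ (κ * y - y′) * r
      forbidden-combine = trans (cong clashing (Fin.remQuot-combine {n} {n} (fromℕ< i<n) (fromℕ< j<n)))
        (cong₂ (λ a b → (κ * pow N.ζ a - pow N.ζ b) * r) (Fin.toℕ-fromℕ< i<n) (Fin.toℕ-fromℕ< j<n))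

    small-root : ∀ {k} → pow k f ≡ 1# → k ≡ 1# ⊎ k ≡ κ ⊎ κ * k ≡ 1#
    small-root k^f with H.root k^f
    ... | 0 , _ , eq = inj₁ eq
    ... | 1 , _ , eq = inj₂ (inj₁ (trans eq (*-identityʳ κ)))
    ... | 2 , 2<f , eq = inj₂ (inj₂ (trans (cong (κ *_) eq) (subst (λ m → pow κ m ≡ 1#) (ℕₚ.≤-antisym f≤3 2<f) H.ζ^n≡1)))
    ... | suc (suc (suc i)) , i<f , _ = contradiction (ℕₚ.≤-trans i<f f≤3) λ { (s≤s (s≤s (s≤s ()))) }

    compatible : ∀ k {y y′} → pow k f ≡ 1# → pow y n ≡ 1# → pow y′ n ≡ 1# → k * (t + y) ≡ t + y′ → k * y ≡ y′
    compatible k {y} {y′} k^f y^n y′^n eq with small-root k^f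
    ... | inj₂ (inj₁ refl) = contradiction eq (clash y^n y′^n)
    ... | inj₂ (inj₂ κk≡1) = contradiction (begin
      κ * (t + y′)         ≡⟨ cong (κ *_) eq ⟨
      κ * (k * (t + y))    ≡⟨ *-assoc _ _ _ ⟨
      κ * k * (t + y)      ≡⟨ cong (_* (t + y)) κk≡1 ⟩
      1# * (t + y)         ≡⟨ *-identityˡ _ ⟩
      t + y                ∎) (clash y′^n y^n)
    ... | inj₁ refl = begin
      1# * y               ≡⟨ solve 2 (λ t y → con (ℤ.+ 1) :* y := con (ℤ.+ 1) :* (t :+ y) :- t) refl t y ⟩
      1# * (t + y) - t     ≡⟨ cong (_- t) eq ⟩
      t + y′ - t           ≡⟨ solve 2 (λ t y → t :+ y :- t := y) refl t y′ ⟩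
      y′                   ∎

  g≢1 : 2 < q → g ≢ 1#
  g≢1 2<q g≡1 = >⇒∤ (ℕₚ.∸-monoˡ-≤ {3} {q} 1 2<q) (pow-g≡1⇒∣ 1 (trans (*-identityʳ g) g≡1))

  -- In characteristic 2 the set V = {0, 1, g, 1 + g} is an additive group of order 4. With ε = 1
  -- the shifts are the translations by its three nonzero elements, and any t outside V keeps t + V
  -- away from 0.
  evenSeed : 1# + 1# ≡ 0# → 4 < q → Seed 1
  evenSeed 2≡0 4<q = CosetTrade.seed 1 t V V? (λ _ → 1#)
    -- Since ε is constantly 1 and f = 1, compatibility asks for k · 1 = 1, which is literally
    -- `pow k 1 ≡ 1#`.
    (λ k k^1 _ _ _ → k^1)
    avoids-0 (λ ())
    (shift 1# 1≢0 V+1) (shift g g≢0 V+g) (shift (1# + g) 1+g≢0 V+1+g)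
    1≢g (λ eq → g≢0 (cancel eq)) (λ eq → 1≢0 (cancel (trans eq (+-comm 1# g))))
    (inj₁ refl) 1≢0
    (λ h k y k^1 _ _ h≡k → trans h≡k k^1)
    where
    V : Carrier → Set
    V y = y ≡ 0# ⊎ y ≡ 1# ⊎ y ≡ g ⊎ y ≡ 1# + g

    V? : Decidable V
    V? y = (y ≟ 0#) ⊎-dec (y ≟ 1#) ⊎-dec (y ≟ g) ⊎-dec (y ≟ 1# + g)

    x+x≡0 : ∀ x → x + x ≡ 0#
    x+x≡0 x = trans (solve 1 (λ x → x :+ x := (con (ℤ.+ 1) :+ con (ℤ.+ 1)) :* x) refl x) (trans (cong (_* x) 2≡0) (zeroˡ x))

    1≢g : 1# ≢ g
    1≢g eq = g≢1 (ℕₚ.<-trans (s≤s (s≤s (s≤s z≤n))) 4<q) (sym eq)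

    1+g≢0 : 1# + g ≢ 0#
    1+g≢0 eq = 1≢g (begin
      1#             ≡⟨ solve 1 (λ g → con (ℤ.+ 1) := con (ℤ.+ 1) :+ g :- g) refl g ⟩
      1# + g - g     ≡⟨ cong (_- g) (trans eq (sym (x+x≡0 g))) ⟩
      g + g - g      ≡⟨ solve 1 (λ g → g :+ g :- g := g) refl g ⟩
      g              ∎)

    cancel : ∀ {x y} → x ≡ x + y → y ≡ 0#
    cancel {x} {y} eq = begin
      y              ≡⟨ solve 2 (λ x y → y := x :+ y :- x) refl x y ⟩
      x + y - x      ≡⟨ cong (_- x) eq ⟨
      x - x          ≡⟨ -‿inverseʳ x ⟩
      0#             ∎

    V+1 : ∀ {y} → V y → V (y + 1#)
    V+1 (inj₁ refl) = inj₂ (inj₁ (+-identityˡ 1#))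
    V+1 (inj₂ (inj₁ refl)) = inj₁ 2≡0
    V+1 (inj₂ (inj₂ (inj₁ refl))) = inj₂ (inj₂ (inj₂ (+-comm g 1#)))
    V+1 (inj₂ (inj₂ (inj₂ refl))) = inj₂ (inj₂ (inj₁ (trans
      (solve 1 (λ g → con (ℤ.+ 1) :+ g :+ con (ℤ.+ 1) := con (ℤ.+ 1) :+ con (ℤ.+ 1) :+ g) refl g)
      (trans (cong (_+ g) 2≡0) (+-identityˡ g)))))

    V+g : ∀ {y} → V y → V (y + g)
    V+g (inj₁ refl) = inj₂ (inj₂ (inj₁ (+-identityˡ g)))
    V+g (inj₂ (inj₁ refl)) = inj₂ (inj₂ (inj₂ refl))
    V+g (inj₂ (inj₂ (inj₁ refl))) = inj₁ (x+x≡0 g)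
    V+g (inj₂ (inj₂ (inj₂ refl))) = inj₂ (inj₁ (trans (+-assoc 1# g g) (trans (cong (1# +_) (x+x≡0 g)) (+-identityʳ 1#))))

    V+1+g : ∀ {y} → V y → V (y + (1# + g))
    V+1+g y∈V = subst V (+-assoc _ 1# g) (V+g (V+1 y∈V))

    shift : ∀ μ → μ ≢ 0# → (∀ {y} → V y → V (y + μ)) → Shift V (λ _ → 1#)
    shift μ μ≢0 closed = record
      { μ = μ ; u = 1# ; μ≢0 = μ≢0 ; u≢0 = 1≢0
      ; closed = λ {y} → subst (λ z → V (y + z)) (sym (*-identityʳ μ)) ∘ closed
      ; scales = λ _ → sym (*-identityˡ 1#) }

    elements : Fin 4 → Carrier
    elements 0F = 0#
    elements 1F = 1#
    elements 2F = g
    elements 3F = 1# + g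

    t : Carrier
    t = proj₁ (outside-image elements 4<q)

    t∉V : ¬ V t
    t∉V = λ where
        (inj₁ eq) → t≢ 0F (sym eq)
        (inj₂ (inj₁ eq)) → t≢ 1F (sym eq)
        (inj₂ (inj₂ (inj₁ eq))) → t≢ 2F (sym eq)
        (inj₂ (inj₂ (inj₂ eq))) → t≢ 3F (sym eq)
      where t≢ = proj₂ (outside-image elements 4<q)

    avoids-0 : ∀ {y} → V y → t + y ≢ 0#
    avoids-0 {y} y∈V eq = t∉V (subst V (begin
      y                ≡⟨ solve 2 (λ t y → y := t :+ y :- t) refl t y ⟩
      t + y - t        ≡⟨ cong (_- t) (trans eq (sym (x+x≡0 t))) ⟩
      t + t - t        ≡⟨ solve 1 (λ t → t :+ t :- t := t) refl t ⟩
      t                ∎) y∈V)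

  -- η(x) = xᶠ⁺¹ is additive, so injectivity of x + μ η(x) means a trivial kernel, that is, -1/μ is
  -- not an f-th power. The elements g^(1 + i f) are not f-th powers, and d > 2 keeps the three
  -- exponents with i < 3 below q - 1, so they are distinct. Exactness comes from evaluation at 1.
  frobeniusSeed : ∀ f d → q ∸ 1 ≡ f ℕ.* d → 1 < f → 2 < d →
    (∀ x y → pow (x + y) (suc f) ≡ pow x (suc f) + pow y (suc f)) → Seed f
  frobeniusSeed f d q∸1≡fd 1<f 2<d additive = record
    { η = η ; η-0 = zeroˡ _ ; η-commutes = η-commutes ; η-exact = η-exact
    ; μ₁ = μ 0 ; μ₂ = μ 1 ; μ₃ = μ 2
    ; μ₁≢0 = μ≢0 0 ; μ₂≢0 = μ≢0 1 ; μ₃≢0 = μ≢0 2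
    ; μ₁≢μ₂ = μ-distinct (s≤s z≤n) (s≤s (s≤s z≤n)) λ () ; μ₁≢μ₃ = μ-distinct (s≤s z≤n) (s≤s (s≤s (s≤s z≤n))) λ ()
    ; μ₂≢μ₃ = μ-distinct (s≤s (s≤s z≤n)) (s≤s (s≤s (s≤s z≤n))) λ ()
    ; η-μ₁ = perturb 0 ; η-μ₂ = perturb 1 ; η-μ₃ = perturb 2 }
    where
    open Roots f d q∸1≡fd using () renaming (n≢0 to f≢0; n-nonZero to f-nonZero; e-nonZero to d-nonZero)

    η : Carrier → Carrier
    η x = pow x (suc f)

    η-commutes : ∀ k → pow k f ≡ 1# → Commutes k η
    η-commutes k k^f x = trans (pow-distrib-* k x (suc f)) (cong (_* η x) (trans (cong (k *_) k^f) (*-identityʳ k)))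

    η-exact : ∀ h → h ≢ 0# → Commutes h η → pow h f ≡ 1#
    η-exact h h≢0 comm = *-cancelˡ h≢0 (begin
      pow h (suc f)            ≡⟨ cong η (*-identityʳ h) ⟨
      η (h * 1#)               ≡⟨ comm 1# ⟩
      h * η 1#                 ≡⟨ cong (h *_) (pow-1 (suc f)) ⟩
      h * 1#                   ∎)

    ν : ℕ → Carrier
    ν i = pow g (1 ℕ.+ i ℕ.* f)

    ν≢0 : ∀ i → ν i ≢ 0#
    ν≢0 i = pow-≢0 (1 ℕ.+ i ℕ.* f) g≢0

    μ : ℕ → Carrier
    μ i = - (ν≢0 i ⁻¹)

    μ≢0 : ∀ i → μ i ≢ 0#
    μ≢0 i = -‿≢0 (*≡1⇒≢0 (trans (*-comm _ _) (*-inverseʳ (ν≢0 i))))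

    νμ : ∀ i → ν i * μ i ≡ - 1#
    νμ i = trans (sym (-‿distribʳ-* _ _)) (cong -_ (*-inverseʳ (ν≢0 i)))

    index<q∸1 : ∀ {i} → i < 3 → 1 ℕ.+ i ℕ.* f < q ∸ 1
    index<q∸1 {i} i<3 = ℕₚ.<-≤-trans (ℕₚ.+-monoˡ-< (i ℕ.* f) 1<f)
      (subst (suc i ℕ.* f ≤_) (trans (ℕₚ.*-comm d f) (sym q∸1≡fd)) (ℕₚ.*-monoˡ-≤ f (ℕₚ.≤-trans i<3 2<d)))

    μ-distinct : ∀ {i j} → i < 3 → j < 3 → i ≢ j → μ i ≢ μ j
    μ-distinct {i} {j} i<3 j<3 i≢j eq = i≢j (ℕₚ.*-cancelʳ-≡ i j f (ℕₚ.suc-injective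
      (pow-g-injective (index<q∸1 i<3) (index<q∸1 j<3) (*-cancelʳ (μ≢0 j)
        (trans (cong (ν i *_) (sym eq)) (trans (νμ i) (sym (νμ j))))))))

    -- x + μ xᶠ⁺¹ has a nonzero root only if xᶠ = −1/μ = ν, but ν is not an f-th power.
    non-power : ∀ i {z} → z ≢ 0# → pow z f ≢ ν i
    non-power i z≢0 eq with log z≢0
    ... | j , refl = ℕₚ.<⇒≢ 1<f (sym (∣1⇒≡1 (∣m+n∣m⇒∣n {m = i ℕ.* f} (subst (f ∣_) (ℕₚ.+-comm 1 _) f∣index) (n∣m*n i))))
      where
      f∣index : f ∣ 1 ℕ.+ i ℕ.* f
      f∣index = *-cancelʳ-∣ d (subst (_∣ (1 ℕ.+ i ℕ.* f) ℕ.* d) q∸1≡fd (pow-g≡1⇒∣ _ (begin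
        pow g ((1 ℕ.+ i ℕ.* f) ℕ.* d)      ≡⟨ pow-* g (1 ℕ.+ i ℕ.* f) d ⟩
        pow (ν i) d                        ≡⟨ cong (λ z → pow z d) eq ⟨
        pow (pow (pow g j) f) d            ≡⟨ pow-* (pow g j) f d ⟨
        pow (pow g j) (f ℕ.* d)            ≡⟨ cong (pow (pow g j)) q∸1≡fd ⟨
        pow (pow g j) (q ∸ 1)              ≡⟨ x^[q∸1]≡1 z≢0 ⟩
        1#                                 ∎)))

    perturb : ∀ i → Perturbs η (μ i)
    perturb i {x} {y} eq with (x - y) ≟ 0#
    ... | yes z≡0 = x-y≡0⇒x≡y x y z≡0
    ... | no z≢0 = contradiction (*-cancelˡ z≢0 (begin
      η z                                 ≡⟨ solve 1 (λ e → e := :- (:- con (ℤ.+ 1) :* e)) refl (η z) ⟩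
      - (- 1# * η z)                      ≡⟨ cong (λ w → - (w * η z)) (νμ i) ⟨
      - (ν i * μ i * η z)                 ≡⟨ solve 4 (λ n m e z → :- (n :* m :* e) := n :* (z :- (z :+ m :* e))) refl (ν i) (μ i) (η z) z ⟩
      ν i * (z - (z + μ i * η z))         ≡⟨ cong (λ w → ν i * (z - w)) kernel ⟩
      ν i * (z - 0#)                      ≡⟨ solve 2 (λ n z → n :* (z :- con (ℤ.+ 0)) := z :* n) refl (ν i) z ⟩
      z * ν i                             ∎)) (non-power i z≢0)
      where
      z : Carrier
      z = x - y
      η-split : η x ≡ η z + η y
      η-split = trans (cong η (solve 2 (λ x y → x := x :- y :+ y) refl x y)) (additive z y)
      kernel : z + μ i * η z ≡ 0#
      kernel = begin
        z + μ i * η z                                    ≡⟨ solve 5 (λ x y m e e′ → x :- y :+ m :* e := x :+ m :* (e :+ e′) :- (y :+ m :* e′)) refl x y (μ i) (η z) (η y) ⟩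
        x + μ i * (η z + η y) - (y + μ i * η y)          ≡⟨ cong (λ e → x + μ i * e - (y + μ i * η y)) η-split ⟨
        x + μ i * η x - (y + μ i * η y)                  ≡⟨ cong (_- (y + μ i * η y)) eq ⟩
        y + μ i * η y - (y + μ i * η y)                  ≡⟨ -‿inverseʳ _ ⟩
        0#                                               ∎

  -- The case d = 1, in which θ is itself linear; it is applied to q = 4. Every nonzero μ works, and
  -- there must be three of them.
  linearSeed : 3 ≤ q ∸ 1 → Seed (q ∸ 1)
  linearSeed 3≤q∸1 = record
    { η = λ _ → 0# ; η-0 = refl
    ; η-commutes = λ k _ _ → sym (zeroʳ k)
    ; η-exact = λ h h≢0 _ → x^[q∸1]≡1 h≢0
    ; μ₁ = pow g 0 ; μ₂ = pow g 1 ; μ₃ = pow g 2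
    ; μ₁≢0 = pow-≢0 0 g≢0 ; μ₂≢0 = pow-≢0 1 g≢0 ; μ₃≢0 = pow-≢0 2 g≢0
    ; μ₁≢μ₂ = distinct 0 1 (λ ()) (s≤s z≤n) (s≤s (s≤s z≤n))
    ; μ₁≢μ₃ = distinct 0 2 (λ ()) (s≤s z≤n) (s≤s (s≤s (s≤s z≤n)))
    ; μ₂≢μ₃ = distinct 1 2 (λ ()) (s≤s (s≤s z≤n)) (s≤s (s≤s (s≤s z≤n)))
    ; η-μ₁ = unmoved ; η-μ₂ = unmoved ; η-μ₃ = unmoved }
    where
    distinct : ∀ i j → i ≢ j → i < 3 → j < 3 → pow g i ≢ pow g j
    distinct i j i≢j i<3 j<3 eq = i≢j (pow-g-injective (ℕₚ.≤-trans i<3 3≤q∸1) (ℕₚ.≤-trans j<3 3≤q∸1) eq)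
    unmoved : ∀ {μ} → Perturbs (λ _ → 0#) μ
    unmoved {μ} {x} {y} eq = trans (sym (clear x)) (trans eq (clear y))
      where
      clear : ∀ x → x + μ * 0# ≡ x
      clear x = solve 2 (λ x m → x :+ m :* con (ℤ.+ 0) := x) refl x μ

-- Prime fields as residues, and seeds given by tables.

entry : List ℕ → ℕ → ℕ
entry [] _ = 0
entry (v ∷ _) zero = v
entry (_ ∷ vs) (suc n) = entry vs n

module TableCheck (p : ℕ) .{{_ : NonZero p}} (f : ℕ) (η̂ : ℕ → ℕ) where

  Commutesᵗ : ℕ → Set
  Commutesᵗ k = ∀ {x} → x < p → η̂ (k ℕ.* x ℕ.% p) ℕ.% p ≡ (k ℕ.* η̂ x) ℕ.% p

  Perturbsᵗ : ℕ → Set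
  Perturbsᵗ μ = ∀ {x} → x < p → ∀ {y} → y < p → (x ℕ.+ μ ℕ.* η̂ x) ℕ.% p ≡ (y ℕ.+ μ ℕ.* η̂ y) ℕ.% p → x ≡ y

  -- The conditions of `Seed` on residues, phrased by bounded quantifiers so as to be decidable.
  -- Exactness is in contrapositive form, and the final chain of inequalities makes the three μ
  -- nonzero and distinct mod p.
  Valid : ℕ → ℕ → ℕ → Set
  Valid μ₁ μ₂ μ₃ =
    η̂ 0 ≡ 0 ×
    (∀ {k} → k < p → (k ℕ.^ f) ℕ.% p ≡ 1 → Commutesᵗ k) ×
    (∀ {h} → h < p → h ≢ 0 → (h ℕ.^ f) ℕ.% p ≢ 1 → ¬ Commutesᵗ h) ×
    Perturbsᵗ μ₁ × Perturbsᵗ μ₂ × Perturbsᵗ μ₃ ×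
    (0 < μ₁ × μ₁ < μ₂ × μ₂ < μ₃ × μ₃ < p)

  commutesᵗ? : Decidable Commutesᵗ
  commutesᵗ? k = ℕₚ.allUpTo? (λ x → _ ℕ.≟ _) p

  perturbsᵗ? : Decidable Perturbsᵗ
  perturbsᵗ? μ = ℕₚ.allUpTo? (λ x → ℕₚ.allUpTo? (λ y → (_ ℕ.≟ _) →-dec (x ℕ.≟ y)) p) p

  valid? : ∀ μ₁ μ₂ μ₃ → Dec (Valid μ₁ μ₂ μ₃)
  valid? μ₁ μ₂ μ₃ =
    (_ ℕ.≟ _) ×-dec
    ℕₚ.allUpTo? (λ k → (_ ℕ.≟ _) →-dec commutesᵗ? k) p ×-dec
    ℕₚ.allUpTo? (λ h → ¬? (h ℕ.≟ 0) →-dec (¬? (_ ℕ.≟ _) →-dec ¬? (commutesᵗ? h))) p ×-dec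
    perturbsᵗ? μ₁ ×-dec perturbsᵗ? μ₂ ×-dec perturbsᵗ? μ₃ ×-dec
    (0 ℕ.<? μ₁) ×-dec (μ₁ ℕ.<? μ₂) ×-dec (μ₂ ℕ.<? μ₃) ×-dec (μ₃ ℕ.<? p)

module PrimeField {p : ℕ} (F : FiniteField p) (prime : Prime p) where
  open Arithmetic F public

  private instance
    p-nonZero : NonZero p
    p-nonZero = prime⇒nonZero prime

  -- A Bézout relation between n and p, mapped into the field where both vanish, would give 1 = 0.
  ι-≢0 : ∀ n → .{{NonZero n}} → n < p → ι n ≢ 0#
  ι-≢0 n n<p ιn≡0 with coprime-Bézout (prime⇒coprime prime n<p)
  ... | Bézout.+- x y eq = 1≢0 (begin
    1#                         ≡⟨ solve 2 (λ u n → con (ℤ.+ 1) := con (ℤ.+ 1) :+ u :* n :- u :* n) refl (ι y) (ι n) ⟩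
    1# + ι y * ι n - ι y * ι n ≡⟨ cong₂ (λ a b → 1# + a - ι y * b) (sym (ι-* y n)) ιn≡0 ⟩
    1# + ι (y ℕ.* n) - ι y * 0# ≡⟨ cong (_- ι y * 0#) (trans (sym (ι-suc (y ℕ.* n))) (trans (cong ι eq) (trans (ι-* x p) (cong (ι x *_) ι-char)))) ⟩
    ι x * 0# - ι y * 0#        ≡⟨ solve 2 (λ x y → x :* con (ℤ.+ 0) :- y :* con (ℤ.+ 0) := con (ℤ.+ 0)) refl (ι x) (ι y) ⟩
    0#                         ∎)
    where open ≡-Reasoning
  ... | Bézout.-+ x y eq = 1≢0 (begin
    1#                         ≡⟨ solve 2 (λ u n → con (ℤ.+ 1) := con (ℤ.+ 1) :+ u :* n :- u :* n) refl (ι x) (ι p) ⟩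
    1# + ι x * ι p - ι x * ι p ≡⟨ cong₂ (λ a b → 1# + a - ι x * b) (sym (ι-* x p)) ι-char ⟩
    1# + ι (x ℕ.* p) - ι x * 0# ≡⟨ cong (_- ι x * 0#) (trans (sym (ι-suc (x ℕ.* p))) (trans (cong ι eq) (trans (ι-* y n) (cong (ι y *_) ιn≡0)))) ⟩
    ι y * 0# - ι x * 0#        ≡⟨ solve 2 (λ x y → x :* con (ℤ.+ 0) :- y :* con (ℤ.+ 0) := con (ℤ.+ 0)) refl (ι y) (ι x) ⟩
    0#                         ∎)
    where open ≡-Reasoning

  private
    ι-injective-≤ : ∀ {m n} → m ≤ n → n < p → ι m ≡ ι n → m ≡ n
    ι-injective-≤ {m} {n} m≤n n<p eq with n ∸ m in n∸m≡k
    ... | zero = ℕₚ.≤-antisym m≤n (ℕₚ.m∸n≡0⇒m≤n n∸m≡k)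
    ... | suc k = contradiction (begin
      ι (suc k)                ≡⟨ solve 2 (λ a b → b := a :+ b :- a) refl (ι m) (ι (suc k)) ⟩
      ι m + ι (suc k) - ι m    ≡⟨ cong (_- ι m) (ι-+ m (suc k)) ⟨
      ι (m ℕ.+ suc k) - ι m    ≡⟨ cong (λ j → ι j - ι m) (trans (cong (m ℕ.+_) (sym n∸m≡k)) (ℕₚ.m+[n∸m]≡n m≤n)) ⟩
      ι n - ι m                ≡⟨ cong (_- ι m) eq ⟨
      ι m - ι m                ≡⟨ -‿inverseʳ _ ⟩
      0#                       ∎) (ι-≢0 (suc k) (ℕₚ.≤-<-trans (subst (_≤ n) n∸m≡k (ℕₚ.m∸n≤m n m)) n<p))
      where open ≡-Reasoning

  ι-injective : ∀ {m n} → m < p → n < p → ι m ≡ ι n → m ≡ n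
  ι-injective {m} {n} m<p n<p eq = case ℕₚ.≤-total m n of λ where
    (inj₁ m≤n) → ι-injective-≤ m≤n n<p eq
    (inj₂ n≤m) → sym (ι-injective-≤ n≤m m<p (sym eq))

  ι-% : ∀ n → ι (n ℕ.% p) ≡ ι n
  ι-% n = begin
    ι (n ℕ.% p)                            ≡⟨ solve 2 (λ r k → r := r :+ k :* con (ℤ.+ 0)) refl _ (ι (n ℕ./ p)) ⟩
    ι (n ℕ.% p) + ι (n ℕ./ p) * 0#         ≡⟨ cong (λ z → ι (n ℕ.% p) + ι (n ℕ./ p) * z) ι-char ⟨
    ι (n ℕ.% p) + ι (n ℕ./ p) * ι p        ≡⟨ cong (ι (n ℕ.% p) +_) (ι-* (n ℕ./ p) p) ⟨
    ι (n ℕ.% p) + ι (n ℕ./ p ℕ.* p)        ≡⟨ ι-+ (n ℕ.% p) _ ⟨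
    ι (n ℕ.% p ℕ.+ n ℕ./ p ℕ.* p)          ≡⟨ cong ι (ℕ.m≡m%n+[m/n]*n n p) ⟨
    ι n                                    ∎
    where open ≡-Reasoning

  ι≡⇒%≡ : ∀ m n → ι m ≡ ι n → m ℕ.% p ≡ n ℕ.% p
  ι≡⇒%≡ m n eq = ι-injective (ℕ.m%n<n m p) (ℕ.m%n<n n p) (trans (ι-% m) (trans eq (sym (ι-% n))))

  %≡⇒ι≡ : ∀ m n → m ℕ.% p ≡ n ℕ.% p → ι m ≡ ι n
  %≡⇒ι≡ m n eq = trans (sym (ι-% m)) (trans (cong ι eq) (ι-% n))

  1<p : 1 < p
  1<p = ℕ.nonTrivial⇒n>1 p {{prime⇒nonTrivial prime}}

  1%p≡1 : 1 ℕ.% p ≡ 1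
  1%p≡1 = ℕ.m<n⇒m%n≡m 1<p

  abstract
    -- The residues below p have distinct images, and there are as many residues as field elements.
    ι-surjective : ∀ x → ∃ λ n → n < p × ι n ≡ x
    ι-surjective x with injective⇒surjective (λ i → card.to (ι (toℕ i)))
      (λ {i} {j} eq → Fin.toℕ-injective (ι-injective (Fin.toℕ<n i) (Fin.toℕ<n j) (card-injective eq))) (card.to x)
    ... | i , eq = toℕ i , Fin.toℕ<n i , card-injective eq

  residue : Carrier → ℕ
  residue x = proj₁ (ι-surjective x)

  residue<p : ∀ x → residue x < p
  residue<p x = proj₁ (proj₂ (ι-surjective x))

  ι-residue : ∀ x → ι (residue x) ≡ x
  ι-residue x = proj₂ (proj₂ (ι-surjective x))

  residue-ι : ∀ n → residue (ι n) ≡ n ℕ.% p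
  residue-ι n = ι-injective (residue<p _) (ℕ.m%n<n n p) (trans (ι-residue (ι n)) (sym (ι-% n)))

  ι-elim : (P : Carrier → Set) → (∀ {n} → n < p → P (ι n)) → ∀ x → P x
  ι-elim P pι x = subst P (ι-residue x) (pι (residue<p x))

module TableSeeds {p : ℕ} (F : FiniteField p) (g : FiniteField.Carrier F) (gen : FiniteField.IsGenerator F g) (prime : Prime p) where
  open Seeds F g gen using (Seed; Commutes; Perturbs)
  open PrimeField F prime

  private instance
    p-nonZero : NonZero p
    p-nonZero = prime⇒nonZero prime

  tableSeed : ∀ f η̂ μ₁ μ₂ μ₃ → TableCheck.Valid p f η̂ μ₁ μ₂ μ₃ → Seed f
  tableSeed f η̂ m₁ m₂ m₃ (η̂-0 , η̂-comm , η̂-exact , perturbs₁ , perturbs₂ , perturbs₃ , 0<m₁ , m₁<m₂ , m₂<m₃ , m₃<p) = record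
    { η = η
    ; η-0 = cong ι (trans (cong η̂ (trans (residue-ι 0) (ℕ.m<n⇒m%n≡m (ℕₚ.<-trans z<s 1<p)))) η̂-0)
    ; η-commutes = η-commutes ; η-exact = η-exact
    ; μ₁ = ι m₁ ; μ₂ = ι m₂ ; μ₃ = ι m₃
    ; μ₁≢0 = ι-≢0 m₁ {{ℕ.>-nonZero 0<m₁}} m₁<p
    ; μ₂≢0 = ι-≢0 m₂ {{ℕ.>-nonZero 0<m₂}} m₂<p
    ; μ₃≢0 = ι-≢0 m₃ {{ℕ.>-nonZero (ℕₚ.<-trans 0<m₂ m₂<m₃)}} m₃<p
    ; μ₁≢μ₂ = ℕₚ.<⇒≢ m₁<m₂ ∘ ι-injective m₁<p m₂<p
    ; μ₁≢μ₃ = ℕₚ.<⇒≢ (ℕₚ.<-trans m₁<m₂ m₂<m₃) ∘ ι-injective m₁<p m₃<p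
    ; μ₂≢μ₃ = ℕₚ.<⇒≢ m₂<m₃ ∘ ι-injective m₂<p m₃<p
    ; η-μ₁ = perturb m₁ perturbs₁ ; η-μ₂ = perturb m₂ perturbs₂ ; η-μ₃ = perturb m₃ perturbs₃ }
    where
    open TableCheck p f η̂
    m₂<p : m₂ < p
    m₂<p = ℕₚ.<-trans m₂<m₃ m₃<p
    m₁<p : m₁ < p
    m₁<p = ℕₚ.<-trans m₁<m₂ m₂<p
    0<m₂ : 0 < m₂
    0<m₂ = ℕₚ.<-trans 0<m₁ m₁<m₂

    η : Carrier → Carrier
    η x = ι (η̂ (residue x))

    η-ι : ∀ {n} → n < p → η (ι n) ≡ ι (η̂ n)
    η-ι {n} n<p = cong (ι ∘ η̂) (trans (residue-ι n) (ℕ.m<n⇒m%n≡m n<p))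

    η-ι* : ∀ k n → η (ι k * ι n) ≡ ι (η̂ (k ℕ.* n ℕ.% p))
    η-ι* k n = trans (cong η (sym (ι-* k n))) (cong (ι ∘ η̂) (residue-ι (k ℕ.* n)))

    commutes⇒ : ∀ {k} → Commutesᵗ k → Commutes (ι k) η
    commutes⇒ {k} comm = ι-elim _ λ {n} n<p → trans (η-ι* k n) (trans (%≡⇒ι≡ _ _ (comm n<p))
      (trans (ι-* k (η̂ n)) (cong (ι k *_) (sym (η-ι n<p)))))

    commutes⇐ : ∀ {k} → Commutes (ι k) η → Commutesᵗ k
    commutes⇐ {k} comm {n} n<p = ι≡⇒%≡ _ _ (trans (sym (η-ι* k n)) (trans (comm (ι n))
      (trans (cong (ι k *_) (η-ι n<p)) (sym (ι-* k (η̂ n))))))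

    η-commutes : ∀ k → pow k f ≡ 1# → Commutes k η
    η-commutes = ι-elim _ λ {n} n<p k^f → commutes⇒ {n} (η̂-comm n<p (trans (ι≡⇒%≡ (n ℕ.^ f) 1 (trans (ι-pow n f) k^f)) 1%p≡1))

    η-exact : ∀ h → h ≢ 0# → Commutes h η → pow h f ≡ 1#
    η-exact = ι-elim _ λ {n} n<p h≢0 comm → decidable-stable (pow (ι n) f ≟ 1#) λ h^f≢1 →
      η̂-exact n<p (λ { refl → h≢0 refl })
        (λ n^f≡1 → h^f≢1 (trans (sym (ι-pow n f)) (%≡⇒ι≡ (n ℕ.^ f) 1 (trans n^f≡1 (sym 1%p≡1)))))
        (commutes⇐ {n} comm)

    perturb : ∀ m → Perturbsᵗ m → Perturbs η (ι m)
    perturb m inj {x} {y} = ι-elim (λ x → x + ι m * η x ≡ y + ι m * η y → x ≡ y)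
      (λ {a} a<p → ι-elim (λ y → ι a + ι m * η (ι a) ≡ y + ι m * η y → ι a ≡ y)
        (λ b<p eq → cong ι (inj a<p b<p (ι≡⇒%≡ _ _ (trans (image a<p) (trans eq (sym (image b<p))))))) y) x
      where
      image : ∀ {n} → n < p → ι (n ℕ.+ m ℕ.* η̂ n) ≡ ι n + ι m * η (ι n)
      image {n} n<p = trans (ι-+ n _) (cong (ι n +_) (trans (ι-* m (η̂ n)) (cong (ι m *_) (sym (η-ι n<p)))))

-- Backtracking search and nonexistence over prime fields.

module Search (p : ℕ) .{{_ : NonZero p}} (multipliers : List ℕ) (s : ℕ) where

  -- Injectivity of θ, θ - x and θ - c x at two points of the graph, with subtractions moved across
  -- so that only natural numbers occur.
  Compatible : ℕ → ℕ × ℕ → ℕ × ℕ → Set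
  Compatible c (x , v) (y , w) = x ≢ y →
    v ≢ w × (v ℕ.+ y) ℕ.% p ≢ (w ℕ.+ x) ℕ.% p × (v ℕ.+ c ℕ.* y) ℕ.% p ≢ (w ℕ.+ c ℕ.* x) ℕ.% p

  compatible? : ∀ c a b → Dec (Compatible c a b)
  compatible? c (x , v) (y , w) = ¬? (x ℕ.≟ y) →-dec
    (¬? (v ℕ.≟ w) ×-dec ¬? (_ ℕ.≟ _) ×-dec ¬? (_ ℕ.≟ _))

  -- `multipliers` are scalars already known to commute with θ, so one value determines θ on a whole
  -- orbit; `s` is the scalar whose commutation is to be forced.
  orbit : ℕ → ℕ → List (ℕ × ℕ)
  orbit x v = map (λ k → k ℕ.* x ℕ.% p , k ℕ.* v ℕ.% p) multipliers

  Equivariant : List (ℕ × ℕ) → Set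
  Equivariant graph = ∀ {x} → x < p → Any (λ (y , v) → y ≡ x ×
    Any (λ (z , w) → z ≡ s ℕ.* x ℕ.% p × w ≡ s ℕ.* v ℕ.% p) graph) graph

  equivariant? : Decidable Equivariant
  equivariant? graph = ℕₚ.allUpTo? (λ x → Any.any? (λ (y , v) → (y ℕ.≟ x) ×-dec
    Any.any? (λ (z , w) → (z ℕ.≟ _) ×-dec (w ℕ.≟ _)) graph) graph) p

  -- Every way to extend the partial graph of a map to the points of the list, compatibly with
  -- orthogonality to x ↦ c x, yields the graph of a map commuting with multiplication by s.
  Forced : ℕ → List (ℕ × ℕ) → List ℕ → Set
  Forced c graph [] = Equivariant graph
  Forced c graph (x ∷ xs) = ∀ {v} → v < p →
    All (λ a → All (Compatible c a) graph) (orbit x v) → Forced c (orbit x v ++ graph) xs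

  forced? : ∀ c graph xs → Dec (Forced c graph xs)
  forced? c graph [] = equivariant? graph
  forced? c graph (x ∷ xs) = ℕₚ.allUpTo? (λ v →
    All.all? (λ a → All.all? (compatible? c a) graph) (orbit x v) →-dec forced? c (orbit x v ++ graph) xs) p

  AllForced : List ℕ → Set
  AllForced xs = ∀ {c} → c < p → c ≢ 0 → c ≢ 1 → Forced c ((0 , 0) ∷ []) xs

  allForced? : Decidable AllForced
  allForced? xs = ℕₚ.allUpTo? (λ c → ¬? (c ℕ.≟ 0) →-dec (¬? (c ℕ.≟ 1) →-dec forced? c ((0 , 0) ∷ []) xs)) p

  -- Passes commutation from `s` to every n-th root of unity, and so to the relevant power of `g`
  -- whichever generator `g` is.
  Powers : ℕ → Set
  Powers n = ∀ {z} → z < p → (z ℕ.^ n) ℕ.% p ≡ 1 → ∃ λ m → m < p × (s ℕ.^ m) ℕ.% p ≡ z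

  powers? : Decidable Powers
  powers? n = ℕₚ.allUpTo? (λ z → (_ ℕ.≟ _) →-dec ℕₚ.anyUpTo? (λ m → (_ ℕ.≟ _)) p) p

-- 2 is a primitive root mod 5, as 3 is mod 7 below, so candidates over these fields are forced to
-- be linear.
allForced₅ : Search.AllForced 5 (1 ∷ []) 2 (1 ∷ 2 ∷ 3 ∷ 4 ∷ [])
allForced₅ = toWitness {a? = Search.allForced? 5 (1 ∷ []) 2 (1 ∷ 2 ∷ 3 ∷ 4 ∷ [])} _

allForced₇ : Search.AllForced 7 (1 ∷ []) 3 (1 ∷ 2 ∷ 3 ∷ 4 ∷ 5 ∷ 6 ∷ [])
allForced₇ = toWitness {a? = Search.allForced? 7 (1 ∷ []) 3 (1 ∷ 2 ∷ 3 ∷ 4 ∷ 5 ∷ 6 ∷ [])} _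

-- 1, 3, 9 are the cube roots of unity mod 13, and 1, 2, 4, 7 represent their four cosets. Since 4
-- has order 6, the index is forced down to 2.
allForced₁₃ : Search.AllForced 13 (1 ∷ 3 ∷ 9 ∷ []) 4 (1 ∷ 2 ∷ 4 ∷ 7 ∷ [])
allForced₁₃ = toWitness {a? = Search.allForced? 13 (1 ∷ 3 ∷ 9 ∷ []) 4 (1 ∷ 2 ∷ 4 ∷ 7 ∷ [])} _

powers₅ : Search.Powers 5 (1 ∷ []) 2 4
powers₅ = toWitness {a? = Search.powers? 5 (1 ∷ []) 2 4} _

powers₇ : Search.Powers 7 (1 ∷ []) 3 6
powers₇ = toWitness {a? = Search.powers? 7 (1 ∷ []) 3 6} _

powers₁₃ : Search.Powers 13 (1 ∷ 3 ∷ 9 ∷ []) 4 6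
powers₁₃ = toWitness {a? = Search.powers? 13 (1 ∷ 3 ∷ 9 ∷ []) 4 6} _

lookup-injective : {A : Set} {xs : List A} → Unique xs → ∀ {i j} → lookup xs i ≡ lookup xs j → i ≡ j
lookup-injective (_ ∷ _) {zero} {zero} _ = refl
lookup-injective (x∉ ∷ _) {zero} {suc j} eq = contradiction eq (All.lookup x∉ (∈-lookup j))
lookup-injective (x∉ ∷ _) {suc i} {zero} eq = contradiction (sym eq) (All.lookup x∉ (∈-lookup i))
lookup-injective (_ ∷ u) {suc i} {suc j} eq = cong suc (lookup-injective u eq)

module Nonexistence {p : ℕ} (F : FiniteField p) (g : FiniteField.Carrier F) (gen : FiniteField.IsGenerator F g) (prime : Prime p) where
  open Cyclic F g gen using (Commutes; cyclotomic⇒commutes; commutes⇒cyclotomic; commutes-pow; pow-g-[q∸1]; g≢0)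
  open PrimeField F prime

  private instance
    p-nonZero : NonZero p
    p-nonZero = prime⇒nonZero prime

  -- The values of θ trace one branch of the search, at whose leaf θ is seen to commute with `s`. It
  -- then commutes with `pow g ℓ`, an n-th root of unity, and its index `ℓ` < d contradicts
  -- minimality.
  not-orthogonal : ∀ multipliers s xs n ℓ → .{{_ : NonZero ℓ}} →
    Search.AllForced p multipliers s xs → Search.Powers p multipliers s n → p ∸ 1 ≡ n ℕ.* ℓ →
    ∀ d → .{{_ : NonZero d}} → ℓ < d → ∀ θ → InD g d θ → All (λ k → Commutes (ι k) θ) multipliers →
    ∀ c → IsLinearMultiplier c → ¬ Orthogonal θ (λ x → c * x)
  not-orthogonal multipliers s xs n ℓ allForced powers p∸1≡nℓ d ℓ<d θ ((cyclotomic , (θ-perm , θ-id-perm)) , minimal) commutes c (c≢0 , c≢1) orth =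
    minimal ℓ ℓ<d (divides n p∸1≡nℓ) (commutes⇒cyclotomic ℓ θ0≡0 commutes-ℓ , θ-perm , θ-id-perm)
    where
    open Search p multipliers s

    θ0≡0 : θ 0# ≡ 0#
    θ0≡0 = proj₁ cyclotomic

    ĉ : ℕ
    ĉ = residue c

    OnGraph : ℕ × ℕ → Set
    OnGraph (x , v) = x < p × ι v ≡ θ (ι x)

    compatible : ∀ {a b} → OnGraph a → OnGraph b → Compatible ĉ a b
    compatible {x , v} {y , w} (x<p , v≡) (y<p , w≡) x≢y =
        (λ v≡w → distinct (proj₁ θ-perm (trans (sym v≡) (trans (cong ι v≡w) w≡))))
      , (λ eq → distinct (proj₁ θ-id-perm (begin
          θ (ι x) - ι x                ≡⟨ solve 3 (λ v x y → v :- x := v :+ y :- (x :+ y)) refl (θ (ι x)) (ι x) (ι y) ⟩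
          θ (ι x) + ι y - (ι x + ι y)  ≡⟨ cong (_- (ι x + ι y)) (trans (cong (_+ ι y) (sym v≡)) (trans (sym (ι-+ v y))
                                           (trans (%≡⇒ι≡ _ _ eq) (trans (ι-+ w x) (cong (_+ ι x) w≡))))) ⟩
          θ (ι y) + ι x - (ι x + ι y)  ≡⟨ solve 3 (λ v x y → v :- y := v :+ x :- (x :+ y)) refl (θ (ι y)) (ι x) (ι y) ⟨
          θ (ι y) - ι y                ∎)))
      , (λ eq → distinct (proj₁ orth (begin
          θ (ι x) - c * ι x                      ≡⟨ solve 4 (λ v x y c → v :- c :* x := v :+ c :* y :- c :* (x :+ y)) refl (θ (ι x)) (ι x) (ι y) c ⟩
          θ (ι x) + c * ι y - c * (ι x + ι y)    ≡⟨ cong (_- c * (ι x + ι y)) (trans (combination {x} {v} v≡ y) (trans (%≡⇒ι≡ _ _ eq) (sym (combination {y} {w} w≡ x)))) ⟩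
          θ (ι y) + c * ι x - c * (ι x + ι y)    ≡⟨ solve 4 (λ v x y c → v :- c :* y := v :+ c :* x :- c :* (x :+ y)) refl (θ (ι y)) (ι x) (ι y) c ⟨
          θ (ι y) - c * ι y                      ∎)))
      where
      open ≡-Reasoning
      distinct : ι x ≢ ι y
      distinct = x≢y ∘ ι-injective x<p y<p
      combination : ∀ {x v} → ι v ≡ θ (ι x) → ∀ y → θ (ι x) + c * ι y ≡ ι (v ℕ.+ ĉ ℕ.* y)
      combination {x} {v} v≡ y = trans (cong₂ _+_ (sym v≡) (trans (cong (_* ι y) (sym (ι-residue c))) (sym (ι-* ĉ y)))) (sym (ι-+ v _))

    -- The branch taken at x is the residue of θ(x); commutation with the multipliers puts its whole
    -- orbit on the graph of θ.
    follow : ∀ graph ys → All OnGraph graph → Forced ĉ graph ys → ∃ λ graph′ → All OnGraph graph′ × Equivariant graph′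
    follow graph [] on eqv = graph , on , eqv
    follow graph (x ∷ ys) on forced = follow (orbit x v ++ graph) ys (All.++⁺ orbit-on on)
      (forced (residue<p _) (All.map (λ a → All.map (λ {b} → compatible a) on) orbit-on))
      where
      v : ℕ
      v = residue (θ (ι x))
      orbit-on : All OnGraph (orbit x v)
      orbit-on = All.map⁺ (All.map (λ {k} comm → ℕ.m%n<n _ p , (begin
        ι (k ℕ.* v ℕ.% p)        ≡⟨ trans (ι-% (k ℕ.* v)) (ι-* k v) ⟩
        ι k * ι v                ≡⟨ cong (ι k *_) (ι-residue _) ⟩
        ι k * θ (ι x)            ≡⟨ comm (ι x) ⟨
        θ (ι k * ι x)            ≡⟨ cong θ (trans (ι-% (k ℕ.* x)) (ι-* k x)) ⟨
        θ (ι (k ℕ.* x ℕ.% p))    ∎)) commutes)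
        where open ≡-Reasoning

    0<p : 0 < p
    0<p = ℕₚ.<-trans z<s 1<p

    final : ∃ λ graph → All OnGraph graph × Equivariant graph
    final = follow _ xs ((0<p , sym θ0≡0) ∷ []) (allForced (residue<p c)
      (λ ĉ≡0 → c≢0 (trans (sym (ι-residue c)) (cong ι ĉ≡0)))
      (λ ĉ≡1 → c≢1 (trans (sym (ι-residue c)) (cong ι ĉ≡1))))

    commutes-s : Commutes (ι s) θ
    commutes-s = ι-elim _ λ {x} x<p → case final of λ where
        (graph , on , eqv) → case witness on (eqv x<p) of λ where
          ((_ , v) , (_ , v≡) , refl , any) → case witness on any of λ where
            (_ , (_ , w≡) , refl , refl) → begin
              θ (ι s * ι x)                                        ≡⟨ cong θ (trans (ι-% (s ℕ.* x)) (ι-* s x)) ⟨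
              θ (ι (s ℕ.* x ℕ.% p))                                ≡⟨ w≡ ⟨
              ι (s ℕ.* v ℕ.% p)                                    ≡⟨ trans (ι-% (s ℕ.* v)) (ι-* s v) ⟩
              ι s * ι v                                            ≡⟨ cong (ι s *_) v≡ ⟩
              ι s * θ (ι x)                                        ∎
      where
      open ≡-Reasoning
      witness : ∀ {graph Q} → All OnGraph graph → Any Q graph → ∃ λ a → OnGraph a × Q a
      witness on any = Any.lookup any , All.lookupAny on any

    commutes-ℓ : Commutes (pow g ℓ) θ
    commutes-ℓ with powers (residue<p (pow g ℓ)) (trans (ι≡⇒%≡ _ 1 (begin
        ι (residue (pow g ℓ) ℕ.^ n)        ≡⟨ ι-pow (residue (pow g ℓ)) n ⟩
        pow (ι (residue (pow g ℓ))) n      ≡⟨ cong (λ z → pow z n) (ι-residue _) ⟩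
        pow (pow g ℓ) n                    ≡⟨ pow-* g ℓ n ⟨
        pow g (ℓ ℕ.* n)                    ≡⟨ cong (pow g) (trans (ℕₚ.*-comm ℓ n) (sym p∸1≡nℓ)) ⟩
        pow g (p ∸ 1)                      ≡⟨ pow-g-[q∸1] ⟩
        1#                                 ∎)) 1%p≡1)
      where open ≡-Reasoning
    ... | m , _ , eq = subst (λ h → Commutes h θ) (trans (sym (ι-pow s m)) (trans (sym (ι-% _)) (trans (cong ι eq) (ι-residue _)))) (commutes-pow commutes-s m)

-- Prime powers and the characteristic.

prime∣power : ∀ {r p} → Prime r → Prime p → ∀ k → r ∣ p ℕ.^ k → r ≡ p
prime∣power r-prime p-prime zero r∣1 = contradiction (subst Prime (∣1⇒≡1 r∣1) r-prime) ¬prime[1]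
prime∣power {r} {p} r-prime p-prime (suc k) r∣pᵏ⁺¹ = case euclidsLemma p (p ℕ.^ k) r-prime r∣pᵏ⁺¹ of λ where
  (inj₂ r∣pᵏ) → prime∣power r-prime p-prime k r∣pᵏ
  (inj₁ r∣p) → case prime⇒irreducible p-prime r∣p of λ where
    (inj₁ refl) → contradiction r-prime ¬prime[1]
    (inj₂ r≡p) → r≡p

unique-prime-divisor : ∀ {q r s} → IsPrimePower q → Prime r → Prime s → r ∣ q → s ∣ q → r ≡ s
unique-prime-divisor (p , k , p-prime , _ , refl) r-prime s-prime r∣q s∣q =
  trans (prime∣power r-prime p-prime k r∣q) (sym (prime∣power s-prime p-prime k s∣q))

module Characteristic {q : ℕ} (F : FiniteField q) where
  open Arithmetic F

  -- The prime is the p of q = pᵏ, and (`ι p`)ᵏ = `ι q` = 0 in a field.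
  ι-prime-divisor : IsPrimePower q → ∀ {r} → Prime r → r ∣ q → ι r ≡ 0#
  ι-prime-divisor (p , k , p-prime , _ , refl) r-prime r∣q with prime∣power r-prime p-prime k r∣q
  ... | refl = decidable-stable (ι p ≟ 0#) λ ιp≢0 → pow-≢0 k ιp≢0 (trans (sym (ι-pow p k)) ι-char)

  -- The additivity that `frobeniusSeed` needs for f = 2; the cross terms carry a factor 3.
  cube-additive : IsPrimePower q → 3 ∣ q → ∀ x y → pow (x + y) 3 ≡ pow x 3 + pow y 3
  cube-additive primePower 3∣q x y = begin
    pow (x + y) 3
      ≡⟨ solve 2 (λ x y → (x :+ y) :* ((x :+ y) :* ((x :+ y) :* con (ℤ.+ 1))) :=
           x :* (x :* (x :* con (ℤ.+ 1))) :+ y :* (y :* (y :* con (ℤ.+ 1))) :+ con (ℤ.+ 3) :* (x :* y :* (x :+ y))) refl x y ⟩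
    pow x 3 + pow y 3 + ι 3 * (x * y * (x + y))
      ≡⟨ cong (λ z → pow x 3 + pow y 3 + z * (x * y * (x + y))) (ι-prime-divisor primePower (from-yes (prime? 3)) 3∣q) ⟩
    pow x 3 + pow y 3 + 0# * (x * y * (x + y))
      ≡⟨ solve 2 (λ u v → u :+ con (ℤ.+ 0) :* v := u) refl _ _ ⟩
    pow x 3 + pow y 3  ∎
    where open ≡-Reasoning

  -- The same for f = 3; here the cross terms carry a factor 2.
  fourth-power-additive : IsPrimePower q → 2 ∣ q → ∀ x y → pow (x + y) 4 ≡ pow x 4 + pow y 4
  fourth-power-additive primePower 2∣q x y = begin
    pow (x + y) 4
      ≡⟨ solve 2 (λ x y → (x :+ y) :* ((x :+ y) :* ((x :+ y) :* ((x :+ y) :* con (ℤ.+ 1)))) :=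
           x :* (x :* (x :* (x :* con (ℤ.+ 1)))) :+ y :* (y :* (y :* (y :* con (ℤ.+ 1)))) :+
           con (ℤ.+ 2) :* (x :* y :* (con (ℤ.+ 2) :* x :* x :+ con (ℤ.+ 3) :* x :* y :+ con (ℤ.+ 2) :* y :* y))) refl x y ⟩
    pow x 4 + pow y 4 + ι 2 * (x * y * (ι 2 * x * x + ι 3 * x * y + ι 2 * y * y))
      ≡⟨ cong (λ z → pow x 4 + pow y 4 + z * (x * y * (ι 2 * x * x + ι 3 * x * y + ι 2 * y * y))) (ι-prime-divisor primePower (from-yes (prime? 2)) 2∣q) ⟩
    pow x 4 + pow y 4 + 0# * (x * y * (ι 2 * x * x + ι 3 * x * y + ι 2 * y * y))
      ≡⟨ solve 2 (λ u v → u :+ con (ℤ.+ 0) :* v := u) refl _ _ ⟩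
    pow x 4 + pow y 4  ∎
    where open ≡-Reasoning

-- Existence: case distinction on f and d.

SubgroupFits : ℕ → ℕ → Set
SubgroupFits f d = ∃ λ n → n < 8 × 4 ≤ n × n ∣ f ℕ.* d × suc (n ℕ.* n) < suc (f ℕ.* d)

-- Certifies that q is not a prime power. For d ≤ 50 and f ≤ 3 one has q ≤ 151, so of two distinct
-- prime divisors the smaller is at most 11 and the larger at most 75.
TwoPrimeDivisors : ℕ → Set
TwoPrimeDivisors q = ∃ λ r → r < 12 × ∃ λ s → s < 76 × r ≢ s × r ∣ q × s ∣ q × Prime r × Prime s

Classified : ℕ → List ℕ → ℕ → Set
Classified f exceptions d = SubgroupFits f d ⊎ TwoPrimeDivisors (suc (f ℕ.* d)) ⊎ d ∈ exceptions

classified? : ∀ f exceptions → Decidable (Classified f exceptions)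
classified? f exceptions d =
  ℕₚ.anyUpTo? (λ n → (4 ℕ.≤? n) ×-dec (n ∣? f ℕ.* d) ×-dec (suc (n ℕ.* n) ℕ.<? suc (f ℕ.* d))) 8 ⊎-dec
  ℕₚ.anyUpTo? (λ r → ℕₚ.anyUpTo? (λ s → ¬? (r ℕ.≟ s) ×-dec (r ∣? suc (f ℕ.* d)) ×-dec (s ∣? suc (f ℕ.* d)) ×-dec prime? r ×-dec prime? s) 76) 12 ⊎-dec
  (d ∈? exceptions)

-- 0 is listed only because d ranges over all d ≤ 50.
exceptions₂ exceptions₃ : List ℕ
exceptions₂ = 0 ∷ 1 ∷ 2 ∷ 3 ∷ 4 ∷ 5 ∷ 6 ∷ 8 ∷ 9 ∷ 11 ∷ 13 ∷ 23 ∷ 29 ∷ 41 ∷ []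
exceptions₃ = 0 ∷ 1 ∷ 2 ∷ 4 ∷ 5 ∷ 6 ∷ []

classification₂ : ∀ {d} → d < 51 → Classified 2 exceptions₂ d
classification₂ = toWitness {a? = ℕₚ.allUpTo? (classified? 2 exceptions₂) 51} _

classification₃ : ∀ {d} → d < 51 → Classified 3 exceptions₃ d
classification₃ = toWitness {a? = ℕₚ.allUpTo? (classified? 3 exceptions₃) 51} _

-- The tables list η(0), η(1), …, and were found by a randomised exact-cover search.
table₁₁ : List ℕ
table₁₁ =
    0 ∷ 9 ∷ 2 ∷ 10 ∷ 10 ∷ 1 ∷ 10 ∷ 1 ∷ 1 ∷ 9 ∷ 2 ∷ []

table₁₃ : List ℕ
table₁₃ =
    0 ∷ 8 ∷ 12 ∷ 8 ∷ 12 ∷ 0 ∷ 0 ∷ 0 ∷ 0 ∷ 1 ∷ 5 ∷ 1 ∷ 5 ∷ []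

table₁₇ : List ℕ
table₁₇ =
    0 ∷ 0 ∷ 1 ∷ 3 ∷ 15 ∷ 0 ∷ 1 ∷ 6 ∷ 0 ∷ 0 ∷ 11 ∷ 16 ∷ 0 ∷ 2 ∷ 14 ∷ 16 ∷ 0 ∷ []

table₁₉ : List ℕ
table₁₉ =
    0 ∷ 14 ∷ 15 ∷ 8 ∷ 10 ∷ 5 ∷ 0 ∷ 5 ∷ 14 ∷ 9 ∷ 10 ∷ 5 ∷ 14 ∷ 0 ∷ 14 ∷ 9 ∷ 11 ∷ 4 ∷ 5 ∷ []

table₂₃ : List ℕ
table₂₃ =
    0 ∷ 4 ∷ 2 ∷ 5 ∷ 9 ∷ 11 ∷ 11 ∷ 18 ∷ 18 ∷ 15 ∷ 22 ∷ 0 ∷ 0 ∷ 1 ∷ 8 ∷ 5 ∷ 5 ∷ 12 ∷ 12 ∷ 14 ∷ 18 ∷ 21 ∷ 19 ∷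
    []

table₄₇ : List ℕ
table₄₇ =
    0 ∷ 27 ∷ 13 ∷ 5 ∷ 18 ∷ 1 ∷ 40 ∷ 37 ∷ 15 ∷ 27 ∷ 3 ∷ 10 ∷ 37 ∷ 16 ∷ 21 ∷ 41 ∷ 21 ∷ 16 ∷ 36 ∷ 23 ∷ 43 ∷ 43 ∷
    45 ∷ 20 ∷ 27 ∷ 2 ∷ 4 ∷ 4 ∷ 24 ∷ 11 ∷ 31 ∷ 26 ∷ 6 ∷ 26 ∷ 31 ∷ 10 ∷ 37 ∷ 44 ∷ 20 ∷ 32 ∷ 10 ∷ 7 ∷ 46 ∷ 29 ∷
    42 ∷ 34 ∷ 20 ∷ []

table₅₉ : List ℕ
table₅₉ =
    0 ∷ 3 ∷ 45 ∷ 25 ∷ 37 ∷ 33 ∷ 26 ∷ 57 ∷ 14 ∷ 27 ∷ 51 ∷ 39 ∷ 5 ∷ 56 ∷ 29 ∷ 38 ∷ 30 ∷ 43 ∷ 49 ∷ 33 ∷ 9 ∷ 18 ∷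
    11 ∷ 17 ∷ 38 ∷ 58 ∷ 47 ∷ 21 ∷ 6 ∷ 45 ∷ 14 ∷ 53 ∷ 38 ∷ 12 ∷ 1 ∷ 21 ∷ 42 ∷ 48 ∷ 41 ∷ 50 ∷ 26 ∷ 10 ∷ 16 ∷
    29 ∷ 21 ∷ 30 ∷ 3 ∷ 54 ∷ 20 ∷ 8 ∷ 32 ∷ 45 ∷ 2 ∷ 33 ∷ 26 ∷ 22 ∷ 34 ∷ 14 ∷ 56 ∷ []

table₈₃ : List ℕ
table₈₃ =
    0 ∷ 19 ∷ 38 ∷ 18 ∷ 7 ∷ 80 ∷ 70 ∷ 20 ∷ 50 ∷ 59 ∷ 19 ∷ 66 ∷ 43 ∷ 78 ∷ 17 ∷ 63 ∷ 68 ∷ 79 ∷ 55 ∷ 76 ∷ 24 ∷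
    29 ∷ 38 ∷ 13 ∷ 45 ∷ 13 ∷ 25 ∷ 74 ∷ 25 ∷ 17 ∷ 77 ∷ 69 ∷ 29 ∷ 66 ∷ 40 ∷ 14 ∷ 50 ∷ 50 ∷ 10 ∷ 3 ∷ 62 ∷ 68 ∷
    15 ∷ 21 ∷ 80 ∷ 73 ∷ 33 ∷ 33 ∷ 69 ∷ 43 ∷ 17 ∷ 54 ∷ 14 ∷ 6 ∷ 66 ∷ 58 ∷ 9 ∷ 58 ∷ 70 ∷ 38 ∷ 70 ∷ 45 ∷ 54 ∷
    59 ∷ 7 ∷ 28 ∷ 4 ∷ 15 ∷ 20 ∷ 66 ∷ 5 ∷ 40 ∷ 17 ∷ 64 ∷ 24 ∷ 33 ∷ 63 ∷ 13 ∷ 3 ∷ 76 ∷ 65 ∷ 45 ∷ 64 ∷ []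

table₁₉′ : List ℕ
table₁₉′ =
    0 ∷ 2 ∷ 2 ∷ 3 ∷ 14 ∷ 11 ∷ 2 ∷ 14 ∷ 7 ∷ 3 ∷ 10 ∷ 3 ∷ 1 ∷ 13 ∷ 14 ∷ 15 ∷ 1 ∷ 7 ∷ 11 ∷ []

-- Writing the order as `suc (f ℕ.* d)` makes q - 1 = f d hold by computation.
HasSeed : ℕ → ℕ → Set₁
HasSeed f d = (F : FiniteField (suc (f ℕ.* d))) (g : FiniteField.Carrier F) (gen : FiniteField.IsGenerator F g) →
  IsPrimePower (suc (f ℕ.* d)) → (suc (f ℕ.* d) , d) ∉ ℰ → Seeds.Seed F g gen f

listed : ∀ {f d} → (suc (f ℕ.* d) , d) ∈ ℰ → HasSeed f d
listed q,d∈ℰ F g gen _ q,d∉ℰ = contradiction q,d∈ℰ q,d∉ℰ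

tabulated : ∀ f d table μ₁ μ₂ μ₃ → True (TableCheck.valid? (suc (f ℕ.* d)) f (entry table) μ₁ μ₂ μ₃) →
  True (prime? (suc (f ℕ.* d))) → HasSeed f d
tabulated f d table μ₁ μ₂ μ₃ valid q-prime F g gen _ _ =
  TableSeeds.tableSeed F g gen (toWitness q-prime) f (entry table) μ₁ μ₂ μ₃ (toWitness valid)

trivial-field : ∀ f → HasSeed f 0
trivial-field f F g gen _ _ = contradiction (Cyclic.0<q∸1 F g gen) (subst (λ n → ¬ 0 < n) (sym (ℕₚ.*-zeroʳ f)) λ ())

exceptional₂ : All (HasSeed 2) exceptions₂
exceptional₂ =
  trivial-field 2 ∷
  listed (from-yes ((3 , 1) ∈ᵖ? ℰ)) ∷
  listed (from-yes ((5 , 2) ∈ᵖ? ℰ)) ∷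
  listed (from-yes ((7 , 3) ∈ᵖ? ℰ)) ∷
  -- Here q = 9; the other ternary case, d = 13, is q = 27.
  ternary 4 (toWitness {a? = _ ℕ.<? _} _) (divides 3 refl) ∷
  tabulated 2 5 table₁₁ 1 2 7 _ _ ∷
  tabulated 2 6 table₁₃ 1 5 6 _ _ ∷
  tabulated 2 8 table₁₇ 1 4 9 _ _ ∷
  tabulated 2 9 table₁₉ 1 3 16 _ _ ∷
  tabulated 2 11 table₂₃ 1 2 7 _ _ ∷
  ternary 13 (toWitness {a? = _ ℕ.<? _} _) (divides 9 refl) ∷
  tabulated 2 23 table₄₇ 1 33 39 _ _ ∷
  tabulated 2 29 table₅₉ 1 36 52 _ _ ∷
  tabulated 2 41 table₈₃ 1 6 24 _ _ ∷ []
  where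
  ternary : ∀ d → 2 < d → 3 ∣ suc (2 ℕ.* d) → HasSeed 2 d
  ternary d 2<d 3∣q F g gen primePower _ =
    SeedFamilies.frobeniusSeed F g gen 2 d refl (s≤s (s≤s z≤n)) 2<d (Characteristic.cube-additive F primePower 3∣q)

exceptional₃ : All (HasSeed 3) exceptions₃
exceptional₃ =
  trivial-field 3 ∷
  (λ F g gen _ _ → SeedFamilies.linearSeed F g gen ℕₚ.≤-refl) ∷
  listed (from-yes ((7 , 2) ∈ᵖ? ℰ)) ∷
  listed (from-yes ((13 , 4) ∈ᵖ? ℰ)) ∷
  -- Here q = 16.
  (λ F g gen primePower _ → SeedFamilies.frobeniusSeed F g gen 3 5 refl (s≤s (s≤s z≤n)) (s≤s (s≤s (s≤s z≤n)))
    (Characteristic.fourth-power-additive F primePower (divides 8 refl))) ∷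
  tabulated 3 6 table₁₉′ 1 2 4 _ _ ∷ []

classified⇒seed : ∀ {f d exceptions} → 1 < f → f ≤ 3 → All (HasSeed f) exceptions → Classified f exceptions d → HasSeed f d
classified⇒seed {f} {d} 1<f f≤3 _ (inj₁ (n , _ , 4≤n , divides e fd≡en , fits)) F g gen _ _ =
  SeedFamilies.translatedSubgroupSeed F g gen f d n e refl (trans fd≡en (ℕₚ.*-comm e n)) 1<f f≤3 4≤n fits
classified⇒seed _ _ _ (inj₂ (inj₁ (r , _ , s , _ , r≢s , r∣q , s∣q , r-prime , s-prime))) F g gen primePower _ =
  contradiction (unique-prime-divisor primePower r-prime s-prime r∣q s∣q) r≢s
classified⇒seed _ _ exceptional (inj₂ (inj₂ d∈)) = All.lookup exceptional d∈

parity : ∀ n → ∃ λ m → n ≡ m ℕ.* 2 ⊎ n ≡ suc (m ℕ.* 2)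
parity zero = 0 , inj₁ refl
parity (suc n) with parity n
... | m , inj₁ refl = m , inj₂ refl
... | m , inj₂ refl = suc m , inj₁ refl

-- If d = 2 n then q is odd and the squares have order n, which is large enough from q = 9 on. If d
-- is odd then q is even, the characteristic is 2, and q > 4 suffices. All smaller fields give pairs
-- of `ℰ`.
seed₁ : ∀ d → HasSeed 1 d
seed₁ d F g gen primePower ∉ℰ with parity d
... | 0 , inj₁ refl = trivial-field 1 F g gen primePower ∉ℰ
... | 1 , inj₁ refl = listed {1} {2} (from-yes ((3 , 2) ∈ᵖ? ℰ)) F g gen primePower ∉ℰ
... | 2 , inj₁ refl = listed {1} {4} (from-yes ((5 , 4) ∈ᵖ? ℰ)) F g gen primePower ∉ℰ
... | 3 , inj₁ refl = listed {1} {6} (from-yes ((7 , 6) ∈ᵖ? ℰ)) F g gen primePower ∉ℰ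
... | n@(suc (suc (suc (suc _)))) , inj₁ refl = SeedFamilies.oddSeed F g gen n (ℕₚ.*-identityˡ _) (s≤s (s≤s (s≤s (s≤s z≤n))))
... | 0 , inj₂ refl = listed {1} {1} (from-yes ((2 , 1) ∈ᵖ? ℰ)) F g gen primePower ∉ℰ
... | 1 , inj₂ refl = listed {1} {3} (from-yes ((4 , 3) ∈ᵖ? ℰ)) F g gen primePower ∉ℰ
... | n@(suc (suc m)) , inj₂ refl = SeedFamilies.evenSeed F g gen
  (Characteristic.ι-prime-divisor F primePower (from-yes (prime? 2)) (divides (suc n) (cong suc (ℕₚ.*-identityˡ _))))
  (s≤s (s≤s (s≤s (s≤s (s≤s z≤n)))))

-- Beyond d = 50, an even d makes the fourth roots of unity available as the group to be translated,
-- while an odd d gives q ≡ 3 mod 4, which is excluded.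
seed₂ : ∀ d → ¬ LargeExcluded (suc (2 ℕ.* d)) d → HasSeed 2 d
seed₂ d ¬large with d ℕ.≤? 50
... | yes d≤50 = classified⇒seed (s≤s (s≤s z≤n)) (s≤s (s≤s z≤n)) exceptional₂ (classification₂ (s≤s d≤50))
... | no d≰50 with parity d
...   | m , inj₁ d≡2m = λ F g gen _ _ → SeedFamilies.translatedSubgroupSeed F g gen 2 d 4 m refl
  (trans (cong (2 ℕ.*_) (trans d≡2m (ℕₚ.*-comm m 2))) (sym (ℕₚ.*-assoc 2 2 m)))
  (s≤s (s≤s z≤n)) (s≤s (s≤s z≤n)) ℕₚ.≤-refl
  (s≤s (ℕₚ.≤-trans (toWitness {a? = 17 ℕ.≤? 51} _) (ℕₚ.≤-trans (ℕₚ.≰⇒> d≰50) (ℕₚ.m≤m+n d _))))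
...   | m , inj₂ refl = contradiction (ℕₚ.≰⇒> d≰50 , inj₁ (ℕₚ.+-comm 1 _ , 3-mod-4)) ¬large
  where
  open ≡-Reasoning
  3-mod-4 : suc (2 ℕ.* suc (m ℕ.* 2)) ℕ.% 4 ≡ 3
  3-mod-4 = begin
    suc (2 ℕ.* suc (m ℕ.* 2)) ℕ.% 4    ≡⟨ cong (λ k → suc k ℕ.% 4) (ℕₚ.*-distribˡ-+ 2 1 (m ℕ.* 2)) ⟩
    (3 ℕ.+ 2 ℕ.* (m ℕ.* 2)) ℕ.% 4      ≡⟨ cong (λ k → (3 ℕ.+ k) ℕ.% 4) (trans (ℕₚ.*-comm 2 (m ℕ.* 2)) (ℕₚ.*-assoc m 2 2)) ⟩
    (3 ℕ.+ m ℕ.* 4) ℕ.% 4              ≡⟨ ℕ.[m+kn]%n≡m%n 3 m 4 ⟩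
    3                                  ∎

seed₃ : ∀ d → ¬ LargeExcluded (suc (3 ℕ.* d)) d → HasSeed 3 d
seed₃ d ¬large with d ℕ.≤? 50
... | yes d≤50 = classified⇒seed (s≤s (s≤s z≤n)) ℕₚ.≤-refl exceptional₃ (classification₃ (s≤s d≤50))
... | no d≰50 = contradiction (ℕₚ.≰⇒> d≰50 , inj₂ (ℕₚ.+-comm 1 _)) ¬large

hasSeed : ∀ f d → ¬ LargeExcluded (suc (f ℕ.* d)) d → HasSeed f d
hasSeed 0 d _ F g gen _ _ = contradiction (Cyclic.0<q∸1 F g gen) λ ()
hasSeed 1 d _ = seed₁ d
hasSeed 2 d ¬large = seed₂ d ¬large
hasSeed 3 d ¬large = seed₃ d ¬large
hasSeed f@(suc (suc (suc (suc _)))) d _ F g gen _ _ = SeedFamilies.subgroupSeed F g gen f d refl (s≤s (s≤s (s≤s (s≤s z≤n))))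

-- Nonexistence for the listed pairs.

module SmallFields {q : ℕ} (F : FiniteField q) where
  open Arithmetic F

  unique-length≤q : ∀ {xs : List Carrier} → Unique xs → length xs ≤ q
  unique-length≤q unique = Fin.injective⇒≤ (lookup-injective unique ∘ card-injective)

  module _ {θ c} (θ0≡0 : θ 0# ≡ 0#) (θ-perm : IsPermutation θ) (θ-id-perm : IsPermutation (λ x → θ x - x))
    (c-multiplier : IsLinearMultiplier c) (orth : Orthogonal θ (λ x → c * x)) {x : Carrier} (x≢0 : x ≢ 0#) where

    θ-≢0 : θ x ≢ 0#
    θ-≢0 eq = x≢0 (proj₁ θ-perm (trans eq (sym θ0≡0)))

    θ-≢id : θ x ≢ x
    θ-≢id eq = x≢0 (proj₁ θ-id-perm (trans (cong (_- x) eq) (trans (-‿inverseʳ x) (sym (trans (cong (_- 0#) θ0≡0) (-‿inverseʳ 0#))))))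

    θ-≢c : θ x ≢ c * x
    θ-≢c eq = x≢0 (proj₁ orth (trans (cong (_- c * x) eq) (trans (-‿inverseʳ _)
      (sym (trans (cong₂ _-_ θ0≡0 (zeroʳ c)) (-‿inverseʳ 0#))))))

    cx≢0 : c * x ≢ 0#
    cx≢0 = *-≢0 (proj₁ c-multiplier) x≢0

    x≢cx : x ≢ c * x
    x≢cx eq = proj₂ c-multiplier (*-cancelˡ x≢0 (trans (*-comm x c) (trans (sym eq) (sym (*-identityʳ x)))))

    -- Injectivity of θ, θ - x and θ - c x keeps θ(x) away from 0, x and c x, which are distinct
    -- because c is neither 0 nor 1.
    4≤q : 4 ≤ q
    4≤q = unique-length≤q {0# ∷ x ∷ c * x ∷ θ x ∷ []}
      ((x≢0 ∘ sym ∷ cx≢0 ∘ sym ∷ θ-≢0 ∘ sym ∷ []) ∷ (x≢cx ∷ θ-≢id ∘ sym ∷ []) ∷ (θ-≢c ∘ sym ∷ []) ∷ [] ∷ [])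

    5≤q : ∀ {y} → y ≢ 0# → y ≢ x → y ≢ c * x → y ≢ θ x → 5 ≤ q
    5≤q {y} y≢0 y≢x y≢cx y≢θx = unique-length≤q {y ∷ 0# ∷ x ∷ c * x ∷ θ x ∷ []}
      ((y≢0 ∷ y≢x ∷ y≢cx ∷ y≢θx ∷ []) ∷
       (x≢0 ∘ sym ∷ cx≢0 ∘ sym ∷ θ-≢0 ∘ sym ∷ []) ∷ (x≢cx ∷ θ-≢id ∘ sym ∷ []) ∷ (θ-≢c ∘ sym ∷ []) ∷ [] ∷ [])

Obstructed : ℕ × ℕ → Set₁
Obstructed (q , d) = .{{_ : NonZero d}} (F : FiniteField q) → let open FiniteField F in
  (g : Carrier) → IsGenerator g → ∀ θ → InD g d θ → ∀ c → IsLinearMultiplier c → ¬ Orthogonal θ (λ x → c * x)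

small-obstructed : ∀ {q d} → q < 4 → Obstructed (q , d)
small-obstructed q<4 F g gen θ ((cyclotomic , θ-perm , θ-id-perm) , _) c c-multiplier orth =
  ℕₚ.<⇒≱ q<4 (SmallFields.4≤q F (proj₁ cyclotomic) θ-perm θ-id-perm c-multiplier orth (Arithmetic.1≢0 F))

-- With four elements, θ(x) is the only one besides 0, x and c x. Since g⁻¹ θ(g x) avoids the same
-- three, it equals θ(x); thus θ commutes with `g` and is linear.
obstructed₄ : Obstructed (4 , 3)
obstructed₄ F g gen θ ((cyclotomic , θ-perm , θ-id-perm) , minimal) c c-multiplier orth =
  minimal 1 (s≤s (s≤s z≤n)) (divides 3 refl)
    (commutes⇒cyclotomic 1 θ0≡0 (subst (λ h → Commutes h θ) (sym (*-identityʳ g)) commutes-g) , θ-perm , θ-id-perm)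
  where
  open Cyclic F g gen
  open SmallFields F
  open ≡-Reasoning
  θ0≡0 : θ 0# ≡ 0#
  θ0≡0 = proj₁ cyclotomic
  g⁻¹ : Carrier
  g⁻¹ = g≢0 ⁻¹
  g-undo : ∀ z → g * (g⁻¹ * z) ≡ z
  g-undo z = trans (sym (*-assoc _ _ _)) (trans (cong (_* z) (*-inverseʳ g≢0)) (*-identityˡ z))
  commutes-g : Commutes g θ
  commutes-g x with x ≟ 0#
  ... | yes refl = trans (cong θ (zeroʳ g)) (trans θ0≡0 (sym (trans (cong (g *_) θ0≡0) (zeroʳ g))))
  ... | no x≢0 with g⁻¹ * θ (g * x) ≟ θ x
  ...   | yes eq = trans (sym (g-undo _)) (cong (g *_) eq)
  ...   | no y≢θx = contradiction
    (5≤q θ0≡0 θ-perm θ-id-perm c-multiplier orth x≢0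
      (λ y≡0 → θ-≢0 θ0≡0 θ-perm θ-id-perm c-multiplier orth gx≢0 (trans (rescale y≡0) (zeroʳ g)))
      (λ y≡x → θ-≢id θ0≡0 θ-perm θ-id-perm c-multiplier orth gx≢0 (rescale y≡x))
      (λ y≡cx → θ-≢c θ0≡0 θ-perm θ-id-perm c-multiplier orth gx≢0 (trans (rescale y≡cx)
        (solve 3 (λ g c x → g :* (c :* x) := c :* (g :* x)) refl g c x)))
      y≢θx) ℕₚ.1+n≰n
    where
    gx≢0 : g * x ≢ 0#
    gx≢0 = *-≢0 g≢0 x≢0
    rescale : ∀ {z} → g⁻¹ * θ (g * x) ≡ z → θ (g * x) ≡ g * z
    rescale eq = trans (sym (g-undo _)) (cong (g *_) eq)

commutes-1 : ∀ {q} (F : FiniteField q) (g : FiniteField.Carrier F) (gen : FiniteField.IsGenerator F g) θ → Cyclic.Commutes F g gen (FiniteField.1# F) θ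
commutes-1 F g gen θ x = trans (cong θ (*-identityˡ x)) (sym (*-identityˡ _))
  where open Arithmetic F

obstructed₅ : ∀ {d} → 1 < d → Obstructed (5 , d)
obstructed₅ {d} 1<d F g gen θ θ∈D = Nonexistence.not-orthogonal F g gen (from-yes (prime? 5))
  (1 ∷ []) 2 (1 ∷ 2 ∷ 3 ∷ 4 ∷ []) 4 1 allForced₅ powers₅ refl d 1<d θ θ∈D (commutes-1 F g gen θ ∷ [])

obstructed₇ : ∀ {d} → 1 < d → Obstructed (7 , d)
obstructed₇ {d} 1<d F g gen θ θ∈D = Nonexistence.not-orthogonal F g gen (from-yes (prime? 7))
  (1 ∷ []) 3 (1 ∷ 2 ∷ 3 ∷ 4 ∷ 5 ∷ 6 ∷ []) 6 1 allForced₇ powers₇ refl d 1<d θ θ∈D (commutes-1 F g gen θ ∷ [])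

-- Index 4 means commutation with the cube roots of unity, and the search upgrades this to the sixth
-- roots of unity, hence to index 2.
obstructed₁₃ : Obstructed (13 , 4)
obstructed₁₃ F g gen θ θ∈D@((cyclotomic , _) , _) = Nonexistence.not-orthogonal F g gen prime₁₃
  (1 ∷ 3 ∷ 9 ∷ []) 4 (1 ∷ 2 ∷ 4 ∷ 7 ∷ []) 6 2 allForced₁₃ powers₁₃ refl 4 (s≤s (s≤s (s≤s z≤n))) θ θ∈D
  (commutes-1 F g gen θ ∷ cube-root 3 refl ∷ cube-root 9 refl ∷ [])
  where
  prime₁₃ : Prime 13
  prime₁₃ = from-yes (prime? 13)
  open SeedFamilies F g gen using (module Roots; Commutes; commutes-pow; cyclotomic⇒commutes)
  open PrimeField F prime₁₃
  cube-root : ∀ k → (k ℕ.^ 3) ℕ.% 13 ≡ 1 → Commutes (ι k) θ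
  cube-root k k³≡1 =
    let i , _ , eq = Roots.root 3 4 refl {ι k} (trans (sym (ι-pow k 3)) (%≡⇒ι≡ (k ℕ.^ 3) 1 k³≡1))
    in subst (λ h → Commutes h θ) (sym eq) (commutes-pow (cyclotomic⇒commutes 4 cyclotomic) i)

obstructions : All Obstructed ℰ
obstructions =
  small-obstructed (s≤s (s≤s (s≤s z≤n))) ∷
  small-obstructed ℕₚ.≤-refl ∷
  small-obstructed ℕₚ.≤-refl ∷
  obstructed₄ ∷
  obstructed₅ (s≤s (s≤s z≤n)) ∷
  obstructed₅ (s≤s (s≤s z≤n)) ∷
  obstructed₇ (s≤s (s≤s z≤n)) ∷
  obstructed₇ (s≤s (s≤s z≤n)) ∷
  obstructed₇ (s≤s (s≤s z≤n)) ∷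
  obstructed₁₃ ∷ []

theorem4p10 : (q : ℕ) → IsPrimePower q → (F : FiniteField q) →
    let open FiniteField F in
    (g : Carrier) → IsGenerator g →
    (d : ℕ) → .{{_ : NonZero d}} → d ∣ q ∸ 1 →
    ((q , d) ∈ ℰ →
    ∀ (θ : Carrier → Carrier) → InD g d θ →
    ∀ (c : Carrier) → IsLinearMultiplier c → ¬ Orthogonal θ (λ x → c * x))
    ×
    ((q , d) ∉ ℰ → ¬ LargeExcluded q d →
    Σ (Carrier → Carrier) λ θ → InD g d θ ×
    Σ Carrier λ c → IsLinearMultiplier c × Orthogonal θ (λ x → c * x))
theorem4p10 q primePower F g gen d d∣q∸1 =
  (λ q,d∈ℰ → All.lookup obstructions q,d∈ℰ F g gen) , positive q primePower F g gen d d∣q∸1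
  where
  positive : ∀ q → IsPrimePower q → (F : FiniteField q) (g : FiniteField.Carrier F) (gen : FiniteField.IsGenerator F g) →
    ∀ d → .{{_ : NonZero d}} → d ∣ q ∸ 1 → (q , d) ∉ ℰ → ¬ LargeExcluded q d → Seeds.Solution F g gen d
  positive q primePower F g gen d (divides f q∸1≡fd) ∉ℰ ¬large
    -- As q is a variable here, it can be replaced throughout by `suc (f ℕ.* d)`, the form used in
    -- `HasSeed`.
    with refl ← trans (Cyclic.q≡1+[q∸1] F g gen) (cong suc q∸1≡fd) =
    Seeds.FromSeed.solution F g gen d f refl (hasSeed f d ¬large F g gen primePower ∉ℰ)
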